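{- Let $s,k,n$ be natural numbers with $s\le n$ and $k\le n$, and let $\mathcal Q_{s,k,n}(t_1,\dots,t_k)=\sum_{\lambda} c_\lambda\, t_{\lambda_1}t_{\lambda_2}\cdots t_{\lambda_d}$ be the polynomial defined in the context, where the sum runs over all integer partitions $\lambda=(\lambda_1\ge\lambda_2\ge\dots\ge\lambda_d\ge1)$ of $k$. For such a partition $\lambda$ with $d$ parts, let $\delta_1,\dots,\delta_q$ be the multiplicities of the distinct values among $\lambda_1,\dots,\lambda_d$ (so $\delta_1+\dots+\delta_q=d$). Then $$c_\lambda=\frac{(-1)^{s+d}\,k!}{\lambda_1!\cdots\lambda_d!\,\delta_1!\cdots\delta_q!}\sum_{p=0}^{s}\ \sum_{\substack{m_1,\dots,m_d\ge1\\ m_1+\dots+m_d=s-p}}(-1)^p\binom np\, m_1^{\lambda_1-1}\cdots m_d^{\lambda_d-1},$$ where the inner sum is over all sequences of $d$ positive integers with sum $s-p$ (an empty inner sum is $0$).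
   Context: For a multiset $A=\{a_1,\dots,a_n\}$ of $n$ complex numbers, $\mathfrak p_j(A)=\sum_{i=1}^n a_i^j$ is its $j$-th power sum, and for $s\le n$, $A^{(s)}$ denotes the multiset of all $\binom ns$ sums $a_{i_1}+\dots+a_{i_s}$ with $1\le i_1<\dots<i_s\le n$ (counted with multiplicity). For $s,k\le n$, $\mathcal Q_{s,k,n}(t_1,\dots,t_k)$ is the unique polynomial with rational coefficients such that for every $n$-multiset $A$ of complex numbers, $\mathfrak p_k(A^{(s)})=\mathcal Q_{s,k,n}(\mathfrak p_1(A),\dots,\mathfrak p_k(A))$ (uniqueness holds because $\mathfrak p_1,\dots,\mathfrak p_n$ are algebraically independent in $n$ variables). $c_\lambda$ is the coefficient of the monomial $t_{\lambda_1}\cdots t_{\lambda_d}$ in $\mathcal Q_{s,k,n}$. -}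

module Defs where

open import Data.Nat as ℕ using (ℕ; zero; suc; _≤_; _∸_; _!; NonZero)
open import Data.Nat.Properties using (_!≢0; m*n≢0)
open import Data.Nat.Combinatorics using (_C_)
open import Data.Integer as ℤ using (ℤ; +_)
open import Data.Rational as ℚ using (ℚ; 0ℚ; 1ℚ)
open import Data.Fin using (Fin; zero; suc; toℕ)
open import Data.Vec as Vec using (Vec; []; _∷_; tabulate)
import Data.Vec.Properties as VecP
open import Data.List as List using (List; []; _∷_; map; upTo; length; filter; deduplicate; zipWith; concatMap; _++_)
open import Data.Nat.ListAction using () renaming (sum to sumℕ; product to productℕ)
open import Data.List.Relation.Unary.All using (All)
open import Data.List.Relation.Unary.Linked using (Linked)
open import Data.Product using (_×_; _,_)
open import Relation.Binary.PropositionalEquality using (_≡_)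
open import Relation.Nullary using (yes; no)

powQ : ℚ → ℕ → ℚ
powQ x zero    = 1ℚ
powQ x (suc j) = x ℚ.* powQ x j

sumQ : List ℚ → ℚ
sumQ []       = 0ℚ
sumQ (x ∷ xs) = x ℚ.+ sumQ xs

powerSum : ℕ → List ℚ → ℚ
powerSum j xs = sumQ (map (λ x → powQ x j) xs)

-- A^{(s)}: the list (multiset) of all sums a_{i_1}+…+a_{i_s}, i_1<…<i_s,
-- counted with multiplicity (one entry for each s-element set of positions)
sSums : ℕ → List ℚ → List ℚ
sSums zero    xs       = 0ℚ ∷ []
sSums (suc s) []       = []
sSums (suc s) (x ∷ xs) = map (x ℚ.+_) (sSums s xs) ++ sSums (suc s) xs

-- A polynomial is a finite list of terms (c , e), with e = (e_1,…,e_k)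
-- the exponent vector of the monomial t_1^{e_1} ⋯ t_k^{e_k}.
-- (Variable t_j corresponds to index j-1 : Fin k.)
Poly : ℕ → Set
Poly k = List (ℚ × Vec ℕ k)

evalMono : ∀ {k} → Vec ℕ k → (Fin k → ℚ) → ℚ
evalMono []       t = 1ℚ
evalMono (e ∷ es) t = powQ (t zero) e ℚ.* evalMono es (λ i → t (suc i))

evalPoly : ∀ {k} → Poly k → (Fin k → ℚ) → ℚ
evalPoly []             t = 0ℚ
evalPoly ((c , e) ∷ Q) t = c ℚ.* evalMono e t ℚ.+ evalPoly Q t

coeff : ∀ {k} → Poly k → Vec ℕ k → ℚ
coeff []             e = 0ℚ
coeff ((c , e′) ∷ Q) e with VecP.≡-dec ℕ._≟_ e′ e
... | yes _ = c ℚ.+ coeff Q e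
... | no  _ = coeff Q e

record IsPartition (k : ℕ) (lam : List ℕ) : Set where
  field
    nonincreasing : Linked ℕ._≥_ lam
    positive      : All (1 ≤_) lam
    sums-to       : sumℕ lam ≡ k

count : ℕ → List ℕ → ℕ
count v lam = length (filter (ℕ._≟ v) lam)

-- exponent vector of the monomial t_{λ_1} t_{λ_2} ⋯ t_{λ_d}:
-- the exponent of t_j is the number of parts equal to j
monoOf : (k : ℕ) → List ℕ → Vec ℕ k
monoOf k lam = tabulate (λ i → count (suc (toℕ i)) lam)

prod! : List ℕ → ℕ
prod! []       = 1
prod! (x ∷ xs) = x ! ℕ.* prod! xs

prod!≢0 : ∀ xs → NonZero (prod! xs)
prod!≢0 []       = _
prod!≢0 (x ∷ xs) = m*n≢0 (x !) (prod! xs) {{x !≢0}} {{prod!≢0 xs}}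

multiplicities : List ℕ → List ℕ
multiplicities lam = map (λ v → count v lam) (deduplicate ℕ._≟_ lam)

den : List ℕ → ℕ
den lam = prod! lam ℕ.* prod! (multiplicities lam)

den≢0 : ∀ lam → NonZero (den lam)
den≢0 lam = m*n≢0 (prod! lam) (prod! (multiplicities lam))
              {{prod!≢0 lam}} {{prod!≢0 (multiplicities lam)}}

comps : ℕ → ℕ → List (List ℕ)
comps zero    zero    = [] ∷ []
comps zero    (suc t) = []
comps (suc d) t       =
  concatMap (λ i → map (suc i ∷_) (comps d (t ∸ suc i))) (upTo t)

sgn : ℕ → ℤ
sgn zero    = + 1
sgn (suc p) = ℤ.- sgn p

sumℤ : List ℤ → ℤ
sumℤ []       = + 0
sumℤ (x ∷ xs) = x ℤ.+ sumℤ xs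

monoVal : List ℕ → List ℕ → ℕ
monoVal lam ms = productℕ (zipWith (λ l m → m ℕ.^ (l ∸ 1)) lam ms)

innerSum : ℕ → ℕ → List ℕ → ℤ
innerSum s n lam =
  sumℤ (map (λ p → sumℤ (map (λ ms → sgn p ℤ.* (+ (n C p)) ℤ.* (+ monoVal lam ms))
                              (comps (length lam) (s ∸ p))))
            (upTo (suc s)))

cFormula : ℕ → ℕ → ℕ → List ℕ → ℚ
cFormula s k n lam =
  ((sgn (s ℕ.+ length lam) ℤ.* (+ (k !)) ℤ.* innerSum s n lam) ℚ./ den lam) {{den≢0 lam}}

{-# OPTIONS --safe #-}

-- Write F_{s,k} = 𝔭_k(A^{(s)}) / k!.  Logarithmic differentiation of
--   Σ_{s,k} F_{s,k} z^s u^k = Π_a (1 + z e^{au}) = (1 + z)^n exp (Σ_{j≥1} 𝔭_j u^j/j! Σ_{m≥1} (-1)^{m-1} m^{j-1} z^m)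
-- in u gives the recursion
--   (k + 1) F_{s,k+1} = Σ_{m≥1} (-1)^{m-1} Σ_j m^j/j! 𝔭_{j+1} F_{s-m,k-j},
-- which has a direct combinatorial proof and whose solution is a polynomial in the 𝔭_j with the claimed coefficients.
-- These coefficients are forced: if R(𝔭_1, 𝔭_2, …) vanishes on all A with at most n elements, then so does ∂R/∂t_j on
-- all A with at most n - j elements (adjoin x to A and compare coefficients of x^j), and differentiating until only
-- A = ∅ remains isolates every coefficient of R of weight at most n.
module Submission where

open import Defs
open import Data.Fin using (zero; suc; toℕ)
open import Data.Integer as ℤ using (ℤ)
import Data.Integer.Properties as ℤ
open import Data.List as List using (List; []; _∷_; map; _++_; length; upTo; applyUpTo; concatMap; filter; deduplicate)
open import Data.List.Membership.Propositional using (_∉_)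
import Data.List.Properties as List
open import Data.List.Relation.Unary.All using (All; []; _∷_)
open import Data.List.Relation.Unary.Any using (here; there)
open import Data.Nat as ℕ using (ℕ; zero; suc; _≤_; _<_; _∸_; _!; z≤n; s≤s)
open import Data.Nat.Combinatorics using (_C_; nCk+nC[k+1]≡[n+1]C[k+1])
open import Data.Nat.Induction using (<-rec)
open import Data.Nat.ListAction using () renaming (sum to sumℕ)
import Data.Nat.Properties as ℕ
open import Data.Product using (Σ; _×_; _,_)
open import Data.Rational using (ℚ; 0ℚ; 1ℚ; _+_; _*_; -_; _-_; _/_; toℚᵘ; 1/_; ≢-nonZero)
open import Data.Rational.Properties
  using ( +-identityˡ; +-identityʳ; +-comm; +-assoc; *-identityˡ; *-identityʳ; *-comm; *-assoc; *-zeroˡ; *-zeroʳ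
        ; *-distribˡ-+; *-distribʳ-+; *-inverseˡ
        ; toℚᵘ-injective; toℚᵘ-homo-+; toℚᵘ-homo-*; toℚᵘ-homo‿-; toℚᵘ-fromℚᵘ)
open import Data.Rational.Solver
import Data.Rational.Unnormalised as ℚᵘ
import Data.Rational.Unnormalised.Properties as ℚᵘ
open import Data.Sum using (_⊎_; inj₁; inj₂)
open import Data.Vec as Vec using (Vec; []; _∷_; toList)
import Data.Vec.Properties as Vec
open import Function using (_∘_)
open import Relation.Binary using (tri<; tri≈; tri>)
open import Relation.Binary.PropositionalEquality
open import Relation.Nullary using (yes; no; contradiction; ¬?)
open +-*-Solver using (solve; _:=_; _:+_; _:*_; _:-_; con) renaming (:-_ to ⊝_)
open ≡-Reasoning

-- The recursion in k arises by lowering z^(k+1)/(k+1)! to z times z^k/k! and reading the factor z,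
-- a sum of chosen elements, as a choice of one of them, y, beside the others. That y must differ
-- from the others prevents the two choices from factoring. Hence all pairs of an element y and an
-- r-element set are summed, with argument m y plus the sum of the set. A pair whose set contains y
-- is a disjoint pair with a smaller set and with m + 1 in place of m. Solving this relation for the
-- disjoint pairs produces the multipliers m and the signs (-1)^(m-1), while the unrestricted sums
-- factor into power sums. The closed form solves the recursion because, at a monomial with
-- exponents e, the term of each variable t_(j+1) reproduces the same coefficient times (j+1) e_j,
-- and these numbers add up to the weight k + 1. In the uniqueness argument the coefficient of
-- x^(j+1) involves the derivatives in all of t_1, ..., t_(j+1), so the lower ones have to be
-- disposed of first, at the cost of one more element each.

-- Integers inside the rationals, and their inverses

ι : ℤ → ℚ
ι i = i / 1

ιℕ : ℕ → ℚ
ιℕ n = ι (ℤ.+ n)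

ι-toℚᵘ : ∀ i → toℚᵘ (ι i) ℚᵘ.≃ ℚᵘ.mkℚᵘ i 0
ι-toℚᵘ i = toℚᵘ-fromℚᵘ (ℚᵘ.mkℚᵘ i 0)

ι-+ : ∀ i j → ι (i ℤ.+ j) ≡ ι i + ι j
ι-+ i j = toℚᵘ-injective (ℚᵘ.≃-trans (ι-toℚᵘ (i ℤ.+ j)) (ℚᵘ.≃-sym
  (ℚᵘ.≃-trans (toℚᵘ-homo-+ (ι i) (ι j)) (ℚᵘ.≃-trans (ℚᵘ.+-cong (ι-toℚᵘ i) (ι-toℚᵘ j))
  (ℚᵘ.*≡* (cong (ℤ._* ℤ.+ 1) (cong₂ ℤ._+_ (ℤ.*-identityʳ i) (ℤ.*-identityʳ j))))))))

ι-* : ∀ i j → ι (i ℤ.* j) ≡ ι i * ι j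
ι-* i j = toℚᵘ-injective (ℚᵘ.≃-trans (ι-toℚᵘ (i ℤ.* j)) (ℚᵘ.≃-sym
  (ℚᵘ.≃-trans (toℚᵘ-homo-* (ι i) (ι j)) (ℚᵘ.≃-trans (ℚᵘ.*-cong (ι-toℚᵘ i) (ι-toℚᵘ j)) (ℚᵘ.*≡* refl)))))

ι-neg : ∀ i → ι (ℤ.- i) ≡ - ι i
ι-neg i = toℚᵘ-injective (ℚᵘ.≃-trans (ι-toℚᵘ (ℤ.- i)) (ℚᵘ.≃-sym
  (ℚᵘ.≃-trans (toℚᵘ-homo‿- (ι i)) (ℚᵘ.-‿cong (ι-toℚᵘ i)))))

ιℕ-+ : ∀ m n → ιℕ (m ℕ.+ n) ≡ ιℕ m + ιℕ n
ιℕ-+ m n = trans (cong ι (ℤ.pos-+ m n)) (ι-+ (ℤ.+ m) (ℤ.+ n))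

ιℕ-* : ∀ m n → ιℕ (m ℕ.* n) ≡ ιℕ m * ιℕ n
ιℕ-* m n = trans (cong ι (ℤ.pos-* m n)) (ι-* (ℤ.+ m) (ℤ.+ n))

ιℕ-suc : ∀ n → ιℕ (suc n) ≡ 1ℚ + ιℕ n
ιℕ-suc n = ιℕ-+ 1 n

-- The junk value inv 0 = 0 makes the inverse total.
inv : ℕ → ℚ
inv zero    = 0ℚ
inv (suc n) = ℤ.+ 1 / suc n

ι/-cancel : ∀ i n .{{_ : ℕ.NonZero n}} → (i / n) * ιℕ n ≡ ι i
ι/-cancel i (suc n) = toℚᵘ-injective (ℚᵘ.≃-trans (toℚᵘ-homo-* (i / suc n) (ιℕ (suc n)))
  (ℚᵘ.≃-trans (ℚᵘ.*-cong (toℚᵘ-fromℚᵘ (ℚᵘ.mkℚᵘ i n)) (ι-toℚᵘ (ℤ.+ suc n)))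
  (ℚᵘ.≃-trans (ℚᵘ.*≡* (trans (ℤ.*-identityʳ (i ℤ.* ℤ.+ suc n)) (cong (λ m → i ℤ.* ℤ.+ suc m) (sym (ℕ.*-identityʳ n)))))
  (ℚᵘ.≃-sym (ι-toℚᵘ i)))))

inv-inverse : ∀ n .{{_ : ℕ.NonZero n}} → inv n * ιℕ n ≡ 1ℚ
inv-inverse (suc n) = ι/-cancel (ℤ.+ 1) (suc n)

ιℕ-cancel : ∀ n .{{_ : ℕ.NonZero n}} {x y} → x * ιℕ n ≡ y * ιℕ n → x ≡ y
ιℕ-cancel n {x} {y} eq = begin
  x                  ≡⟨ expand x ⟩
  x * ιℕ n * inv n   ≡⟨ cong (_* inv n) eq ⟩
  y * ιℕ n * inv n   ≡⟨ expand y ⟨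
  y                  ∎
  where
  expand : ∀ z → z ≡ z * ιℕ n * inv n
  expand z = sym (trans (*-assoc z (ιℕ n) (inv n))
    (trans (cong (z *_) (trans (*-comm (ιℕ n) (inv n)) (inv-inverse n))) (*-identityʳ z)))

-- Cauchy products of sequences

Seq : Set
Seq = ℕ → ℚ

infix 4 _≗ₛ_
_≗ₛ_ : Seq → Seq → Set
a ≗ₛ b = ∀ k → a k ≡ b k

conv : Seq → Seq → Seq
conv a b zero    = a 0 * b 0
conv a b (suc k) = a 0 * b (suc k) + conv (a ∘ suc) b k

conv-cong : ∀ {a a′ b b′} → a ≗ₛ a′ → b ≗ₛ b′ → conv a b ≗ₛ conv a′ b′
conv-cong p q zero    = cong₂ _*_ (p 0) (q 0)
conv-cong p q (suc k) = cong₂ _+_ (cong₂ _*_ (p 0) (q (suc k))) (conv-cong (p ∘ suc) q k)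

conv-distribˡ : ∀ a b c → conv a (λ i → b i + c i) ≗ₛ (λ k → conv a b k + conv a c k)
conv-distribˡ a b c zero    = *-distribˡ-+ (a 0) (b 0) (c 0)
conv-distribˡ a b c (suc k) = trans (cong (_+_ (a 0 * (b (suc k) + c (suc k)))) (conv-distribˡ (a ∘ suc) b c k))
  (solve 5 (λ x y z u v → x :* (y :+ z) :+ (u :+ v) := x :* y :+ u :+ (x :* z :+ v)) refl
    (a 0) (b (suc k)) (c (suc k)) (conv (a ∘ suc) b k) (conv (a ∘ suc) c k))

conv-sucʳ : ∀ a b k → conv a b (suc k) ≡ conv a (b ∘ suc) k + a (suc k) * b 0
conv-sucʳ a b zero    = refl
conv-sucʳ a b (suc k) = trans (cong (_+_ (a 0 * b (suc (suc k)))) (conv-sucʳ (a ∘ suc) b k))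
  (sym (+-assoc (a 0 * b (suc (suc k))) (conv (a ∘ suc) (b ∘ suc) k) (a (suc (suc k)) * b 0)))

conv-comm : ∀ a b → conv a b ≗ₛ conv b a
conv-comm a b zero    = *-comm (a 0) (b 0)
conv-comm a b (suc k) = begin
  a 0 * b (suc k) + conv (a ∘ suc) b k   ≡⟨ cong₂ _+_ (*-comm (a 0) (b (suc k))) (conv-comm (a ∘ suc) b k) ⟩
  b (suc k) * a 0 + conv b (a ∘ suc) k   ≡⟨ +-comm (b (suc k) * a 0) (conv b (a ∘ suc) k) ⟩
  conv b (a ∘ suc) k + b (suc k) * a 0   ≡⟨ conv-sucʳ b a k ⟨
  conv b a (suc k)                       ∎

conv-scaleˡ : ∀ x a b → conv (λ i → x * a i) b ≗ₛ (λ k → x * conv a b k)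
conv-scaleˡ x a b zero    = *-assoc x (a 0) (b 0)
conv-scaleˡ x a b (suc k) = trans (cong (_+_ (x * a 0 * b (suc k))) (conv-scaleˡ x (a ∘ suc) b k))
  (solve 4 (λ x y z u → x :* y :* z :+ x :* u := x :* (y :* z :+ u)) refl x (a 0) (b (suc k)) (conv (a ∘ suc) b k))

conv-scaleʳ : ∀ x a b → conv a (λ i → x * b i) ≗ₛ (λ k → x * conv a b k)
conv-scaleʳ x a b k = trans (conv-comm a _ k) (trans (conv-scaleˡ x b a k) (cong (x *_) (conv-comm b a k)))

conv-distribʳ : ∀ a b c → conv (λ i → a i + b i) c ≗ₛ (λ k → conv a c k + conv b c k)
conv-distribʳ a b c k = trans (conv-comm _ c k) (trans (conv-distribˡ c a b k)
  (cong₂ _+_ (conv-comm c a k) (conv-comm c b k)))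

conv-assoc : ∀ a b c → conv (conv a b) c ≗ₛ conv a (conv b c)
conv-assoc a b c zero    = *-assoc (a 0) (b 0) (c 0)
conv-assoc a b c (suc k) = begin
  a 0 * b 0 * c (suc k) + conv (λ i → a 0 * b (suc i) + conv (a ∘ suc) b i) c k
    ≡⟨ cong (_+_ (a 0 * b 0 * c (suc k))) (trans (conv-distribʳ (λ i → a 0 * b (suc i)) (conv (a ∘ suc) b) c k)
         (cong₂ _+_ (conv-scaleˡ (a 0) (b ∘ suc) c k) (conv-assoc (a ∘ suc) b c k))) ⟩
  a 0 * b 0 * c (suc k) + (a 0 * conv (b ∘ suc) c k + conv (a ∘ suc) (conv b c) k)
    ≡⟨ solve 5 (λ x y z u v → x :* y :* z :+ (x :* u :+ v) := x :* (y :* z :+ u) :+ v) refl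
         (a 0) (b 0) (c (suc k)) (conv (b ∘ suc) c k) (conv (a ∘ suc) (conv b c) k) ⟩
  a 0 * (b 0 * c (suc k) + conv (b ∘ suc) c k) + conv (a ∘ suc) (conv b c) k ∎

conv-swap : ∀ a b c → conv a (conv b c) ≗ₛ conv b (conv a c)
conv-swap a b c k = trans (sym (conv-assoc a b c k))
  (trans (conv-cong (conv-comm a b) (λ _ → refl) k) (conv-assoc b a c k))

conv-zeroˡ : ∀ b → conv (λ _ → 0ℚ) b ≗ₛ (λ _ → 0ℚ)
conv-zeroˡ b zero    = *-zeroˡ (b 0)
conv-zeroˡ b (suc k) = trans (cong₂ _+_ (*-zeroˡ (b (suc k))) (conv-zeroˡ b k)) (+-identityˡ 0ℚ)

conv-zeroʳ : ∀ a → conv a (λ _ → 0ℚ) ≗ₛ (λ _ → 0ℚ)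
conv-zeroʳ a k = trans (conv-comm a _ k) (conv-zeroˡ a k)

-- The Euler operator x d/dx on the coefficients of a power series. It preserves degrees, so the
-- Leibniz rule `θ-conv` involves no index shift.
θ : Seq → Seq
θ a i = ιℕ i * a i

θ-conv : ∀ a b → θ (conv a b) ≗ₛ (λ k → conv (θ a) b k + conv a (θ b) k)
θ-conv a b zero    = solve 2 (λ x y → con 0ℚ :* (x :* y) := con 0ℚ :* x :* y :+ x :* (con 0ℚ :* y)) refl (a 0) (b 0)
θ-conv a b (suc k) = begin
  ιℕ (suc k) * (a 0 * b (suc k) + conv a′ b k)
    ≡⟨ solve 4 (λ n x y c → n :* (x :* y :+ c) := x :* (n :* y) :+ n :* c) refl (ιℕ (suc k)) (a 0) (b (suc k)) (conv a′ b k) ⟩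
  y + ιℕ (suc k) * conv a′ b k
    ≡⟨ cong (λ z → y + z * conv a′ b k) (ιℕ-suc k) ⟩
  y + (1ℚ + ιℕ k) * conv a′ b k
    ≡⟨ solve 3 (λ n c y → y :+ (con 1ℚ :+ n) :* c := y :+ (c :+ n :* c)) refl (ιℕ k) (conv a′ b k) y ⟩
  y + (conv a′ b k + ιℕ k * conv a′ b k)
    ≡⟨ cong (λ z → y + (conv a′ b k + z)) (θ-conv a′ b k) ⟩
  y + (conv a′ b k + (conv (θ a′) b k + conv a′ (θ b) k))
    ≡⟨ solve 6 (λ y c u v p q → y :+ (c :+ (u :+ v)) := con 0ℚ :* p :* q :+ (c :+ u) :+ (y :+ v)) refl
         y (conv a′ b k) (conv (θ a′) b k) (conv a′ (θ b) k) (a 0) (b (suc k)) ⟩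
  0ℚ * a 0 * b (suc k) + (conv a′ b k + conv (θ a′) b k) + (y + conv a′ (θ b) k)
    ≡⟨ cong (λ z → 0ℚ * a 0 * b (suc k) + z + (y + conv a′ (θ b) k)) (conv-distribʳ a′ (θ a′) b k) ⟨
  0ℚ * a 0 * b (suc k) + conv (λ i → a′ i + θ a′ i) b k + (y + conv a′ (θ b) k)
    ≡⟨ cong (λ z → 0ℚ * a 0 * b (suc k) + z + (y + conv a′ (θ b) k)) (conv-cong θ-suc (λ _ → refl) k) ⟨
  conv (θ a) b (suc k) + conv a (θ b) (suc k) ∎
  where
  a′ = a ∘ suc
  y = a 0 * (ιℕ (suc k) * b (suc k))
  θ-suc : ∀ i → θ a (suc i) ≡ a′ i + θ a′ i
  θ-suc i = trans (cong (_* a′ i) (ιℕ-suc i))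
    (trans (*-distribʳ-+ (a′ i) 1ℚ (ιℕ i)) (cong (_+ θ a′ i) (*-identityˡ (a′ i))))

-- Finite sums

Σ< : ℕ → (ℕ → ℚ) → ℚ
Σ< zero    f = 0ℚ
Σ< (suc N) f = f 0 + Σ< N (f ∘ suc)

Σ<-cong : ∀ N {f g} → (∀ i → f i ≡ g i) → Σ< N f ≡ Σ< N g
Σ<-cong zero    p = refl
Σ<-cong (suc N) p = cong₂ _+_ (p 0) (Σ<-cong N (p ∘ suc))

*-Σ< : ∀ N x f → x * Σ< N f ≡ Σ< N (λ i → x * f i)
*-Σ< zero    x f = *-zeroʳ x
*-Σ< (suc N) x f = trans (*-distribˡ-+ x (f 0) (Σ< N (f ∘ suc))) (cong (_+_ (x * f 0)) (*-Σ< N x (f ∘ suc)))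

Σ<-+ : ∀ N f g → Σ< N (λ i → f i + g i) ≡ Σ< N f + Σ< N g
Σ<-+ zero    f g = refl
Σ<-+ (suc N) f g = trans (cong (_+_ (f 0 + g 0)) (Σ<-+ N (f ∘ suc) (g ∘ suc)))
  (solve 4 (λ x y u v → x :+ y :+ (u :+ v) := x :+ u :+ (y :+ v)) refl (f 0) (g 0) (Σ< N (f ∘ suc)) (Σ< N (g ∘ suc)))

Σ<-zero : ∀ N f → (∀ i → f i ≡ 0ℚ) → Σ< N f ≡ 0ℚ
Σ<-zero zero    f p = refl
Σ<-zero (suc N) f p = trans (cong₂ _+_ (p 0) (Σ<-zero N (f ∘ suc) (p ∘ suc))) (+-identityˡ 0ℚ)

Σ<-single : ∀ N f j → j < N → (∀ i → i ≢ j → f i ≡ 0ℚ) → Σ< N f ≡ f j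
Σ<-single (suc N) f zero    _       p = trans (cong (f 0 +_) (Σ<-zero N (f ∘ suc) (λ i → p (suc i) (λ ()))))
  (+-identityʳ (f 0))
Σ<-single (suc N) f (suc j) (s≤s q) p = trans (cong (_+ Σ< N (f ∘ suc)) (p 0 (λ ())))
  (trans (+-identityˡ (Σ< N (f ∘ suc)))
         (Σ<-single N (f ∘ suc) j q (λ i i≢j → p (suc i) (λ eq → i≢j (ℕ.suc-injective eq)))))

conv-Σ< : ∀ N a (w : Seq) (F : ℕ → Seq) →
  conv a (λ m → Σ< N (λ i → w i * F i m)) ≗ₛ (λ m → Σ< N (λ i → w i * conv a (F i) m))
conv-Σ< zero    a w F k = conv-zeroʳ a k
conv-Σ< (suc N) a w F k = trans (conv-distribˡ a _ _ k)
  (cong₂ _+_ (conv-scaleʳ (w 0) a (F 0) k) (conv-Σ< N a (w ∘ suc) (F ∘ suc) k))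

-- Exponent vectors and products of series

at : ∀ {K} → Vec ℕ K → ℕ → ℕ
at []       i       = 0
at (e ∷ es) zero    = e
at (e ∷ es) (suc i) = at es i

-- The identity where the entry is 0. In derivatives this default is harmless, because the entry
-- itself occurs there as a factor.
dec : ∀ {K} → Vec ℕ K → ℕ → Vec ℕ K
dec []       i       = []
dec (e ∷ es) zero    = (e ∸ 1) ∷ es
dec (e ∷ es) (suc i) = e ∷ dec es i

-- The product of b with e copies of a. Carrying b along lets one construction serve both for b = 1
-- and for b = (1 + z)^n.
convPow : Seq → ℕ → Seq → Seq
convPow a zero    b = b
convPow a (suc e) b = conv a (convPow a e b)

convProd : ∀ {K} → (ℕ → Seq) → Seq → Vec ℕ K → Seq
convProd g b []       = b
convProd g b (e ∷ es) = convPow (g 0) e (convProd (g ∘ suc) b es)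

convPow-cong : ∀ a e {b b′} → b ≗ₛ b′ → convPow a e b ≗ₛ convPow a e b′
convPow-cong a zero    p = p
convPow-cong a (suc e) p = conv-cong (λ _ → refl) (convPow-cong a e p)

convPow-conv : ∀ a e c b → convPow a e (conv c b) ≗ₛ conv c (convPow a e b)
convPow-conv a zero    c b k = refl
convPow-conv a (suc e) c b k = trans (conv-cong (λ _ → refl) (convPow-conv a e c b) k)
  (conv-swap a c (convPow a e b) k)

convPow-Σ< : ∀ N a e (w : Seq) (F : ℕ → Seq) →
  convPow a e (λ m → Σ< N (λ i → w i * F i m)) ≗ₛ (λ m → Σ< N (λ i → w i * convPow a e (F i) m))
convPow-Σ< N a zero    w F k = refl
convPow-Σ< N a (suc e) w F k = trans (conv-cong (λ _ → refl) (convPow-Σ< N a e w F) k)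
  (conv-Σ< N a w (λ i → convPow a e (F i)) k)

convProd-dec : ∀ {K} g b (e : Vec ℕ K) i {m} → at e i ≡ suc m →
  convProd g b e ≗ₛ conv (g i) (convProd g b (dec e i))
convProd-dec g b (suc e ∷ es) zero    eq k = refl
convProd-dec g b (e ∷ es)     (suc i) eq k =
  trans (convPow-cong (g 0) e (convProd-dec (g ∘ suc) b es i eq) k)
        (convPow-conv (g 0) e (g (suc i)) (convProd (g ∘ suc) b (dec es i)) k)

-- The power rule, e a^(e-1) θ(a) b + a^e θ(b). At e = 0 the truncated `e ∸ 1` is multiplied by 0.
θ-convPow : ∀ a e b → θ (convPow a e b) ≗ₛ
  (λ m → ιℕ e * conv (θ a) (convPow a (e ∸ 1) b) m + convPow a e (θ b) m)
θ-convPow a zero    b k = sym (trans (cong (_+ θ b k) (*-zeroˡ (conv (θ a) b k))) (+-identityˡ (θ b k)))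
θ-convPow a (suc e) b k = begin
  θ (conv a (convPow a e b)) k
    ≡⟨ θ-conv a (convPow a e b) k ⟩
  x + conv a (θ (convPow a e b)) k
    ≡⟨ cong (x +_) (conv-cong (λ _ → refl) (θ-convPow a e b) k) ⟩
  x + conv a (λ m → ιℕ e * conv (θ a) (convPow a (e ∸ 1) b) m + convPow a e (θ b) m) k
    ≡⟨ cong (x +_) (conv-distribˡ a _ _ k) ⟩
  x + (conv a (λ m → ιℕ e * conv (θ a) (convPow a (e ∸ 1) b) m) k + z)
    ≡⟨ cong (λ u → x + (u + z)) (trans (conv-scaleʳ (ιℕ e) a _ k) (lower e)) ⟩
  x + (ιℕ e * x + z)
    ≡⟨ solve 3 (λ x e z → x :+ (e :* x :+ z) := (con 1ℚ :+ e) :* x :+ z) refl x (ιℕ e) z ⟩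
  (1ℚ + ιℕ e) * x + z
    ≡⟨ cong (λ u → u * x + z) (ιℕ-suc e) ⟨
  ιℕ (suc e) * x + z ∎
  where
  x = conv (θ a) (convPow a e b) k
  z = conv a (convPow a e (θ b)) k
  lower : ∀ e → ιℕ e * conv a (conv (θ a) (convPow a (e ∸ 1) b)) k ≡ ιℕ e * conv (θ a) (convPow a e b) k
  lower zero    = trans (*-zeroˡ (conv a (conv (θ a) b) k)) (sym (*-zeroˡ (conv (θ a) b k)))
  lower (suc e) = cong (ιℕ (suc e) *_) (conv-swap a (θ a) (convPow a e b) k)

-- The power rule summed over all factors. The hypothesis makes b a constant series, so b adds no
-- term of its own.
θ-convProd : ∀ {K} g b (e : Vec ℕ K) → (∀ m → θ b m ≡ 0ℚ) →
  θ (convProd g b e) ≗ₛ (λ m → Σ< K (λ i → ιℕ (at e i) * conv (θ (g i)) (convProd g b (dec e i)) m))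
θ-convProd g b []       p k = p k
θ-convProd {suc K} g b (e ∷ es) p k = trans (θ-convPow (g 0) e (convProd (g ∘ suc) b es) k)
  (cong (_+_ (ιℕ e * conv (θ (g 0)) (convPow (g 0) (e ∸ 1) (convProd (g ∘ suc) b es)) k)) (begin
    convPow (g 0) e (θ (convProd (g ∘ suc) b es)) k
      ≡⟨ convPow-cong (g 0) e (θ-convProd (g ∘ suc) b es p) k ⟩
    convPow (g 0) e (λ m → Σ< K (λ i → ιℕ (at es i) * conv (θ (g (suc i))) (convProd (g ∘ suc) b (dec es i)) m)) k
      ≡⟨ convPow-Σ< K (g 0) e (ιℕ ∘ at es) _ k ⟩
    Σ< K (λ i → ιℕ (at es i) * convPow (g 0) e (conv (θ (g (suc i))) (convProd (g ∘ suc) b (dec es i))) k)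
      ≡⟨ Σ<-cong K (λ i → cong (ιℕ (at es i) *_) (convPow-conv (g 0) e (θ (g (suc i))) _ k)) ⟩
    Σ< K (λ i → ιℕ (at es i) * conv (θ (g (suc i))) (convPow (g 0) e (convProd (g ∘ suc) b (dec es i))) k) ∎))

-- The series x^j; convolution with it shifts by j places.
δ : ℕ → Seq
δ zero    zero    = 1ℚ
δ zero    (suc m) = 0ℚ
δ (suc j) zero    = 0ℚ
δ (suc j) (suc m) = δ j m

conv-δ0 : ∀ c → conv (δ 0) c ≗ₛ c
conv-δ0 c zero    = *-identityˡ (c 0)
conv-δ0 c (suc k) = trans (cong₂ _+_ (*-identityˡ (c (suc k))) (conv-zeroˡ c k)) (+-identityʳ (c (suc k)))

conv-δ-zero : ∀ j c → conv (δ (suc j)) c 0 ≡ 0ℚ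
conv-δ-zero j c = *-zeroˡ (c 0)

conv-δ-suc : ∀ j c k → conv (δ (suc j)) c (suc k) ≡ conv (δ j) c k
conv-δ-suc j c k = trans (cong (_+ conv (δ j) c k) (*-zeroˡ (c (suc k)))) (+-identityˡ (conv (δ j) c k))

conv-δ-< : ∀ {j k} c → k < j → conv (δ j) c k ≡ 0ℚ
conv-δ-< {suc j} {zero}  c _       = conv-δ-zero j c
conv-δ-< {suc j} {suc k} c (s≤s p) = trans (conv-δ-suc j c k) (conv-δ-< c p)

conv-δ-self : ∀ j c → conv (δ j) c j ≡ c 0
conv-δ-self zero    c = conv-δ0 c 0
conv-δ-self (suc j) c = trans (conv-δ-suc j c j) (conv-δ-self j c)

θ-δ : ∀ j → θ (δ j) ≗ₛ (λ m → ιℕ j * δ j m)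
θ-δ zero    zero    = refl
θ-δ zero    (suc m) = trans (*-zeroʳ (ιℕ (suc m))) (sym (*-zeroʳ (ιℕ 0)))
θ-δ (suc j) zero    = trans (*-zeroʳ (ιℕ 0)) (sym (*-zeroʳ (ιℕ (suc j))))
θ-δ (suc j) (suc m) = begin
  ιℕ (suc m) * δ j m     ≡⟨ peel m ⟩
  δ j m + ιℕ m * δ j m   ≡⟨ cong (δ j m +_) (θ-δ j m) ⟩
  δ j m + ιℕ j * δ j m   ≡⟨ peel j ⟨
  ιℕ (suc j) * δ j m     ∎
  where
  peel : ∀ n → ιℕ (suc n) * δ j m ≡ δ j m + ιℕ n * δ j m
  peel n = trans (cong (_* δ j m) (ιℕ-suc n))
    (solve 2 (λ n x → (con 1ℚ :+ n) :* x := x :+ n :* x) refl (ιℕ n) (δ j m))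
-- Polynomial functions of one variable

*-zero-cancelˡ : ∀ {x y} → x ≢ 0ℚ → x * y ≡ 0ℚ → y ≡ 0ℚ
*-zero-cancelˡ {x} {y} x≢0 xy≡0 = begin
  y                ≡⟨ *-identityˡ y ⟨
  1ℚ * y           ≡⟨ cong (_* y) (*-inverseˡ x) ⟨
  1/ x * x * y     ≡⟨ *-assoc (1/ x) x y ⟩
  1/ x * (x * y)   ≡⟨ cong (1/ x *_) xy≡0 ⟩
  1/ x * 0ℚ        ≡⟨ *-zeroʳ (1/ x) ⟩
  0ℚ               ∎
  where instance _ = ≢-nonZero x≢0

ιℕ-*-zero : ∀ n .{{_ : ℕ.NonZero n}} {x} → ιℕ n * x ≡ 0ℚ → x ≡ 0ℚ
ιℕ-*-zero n {x} eq = ιℕ-cancel n (trans (*-comm x (ιℕ n)) (trans eq (sym (*-zeroˡ (ιℕ n)))))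

horner : List ℚ → ℚ → ℚ
horner []      x = 0ℚ
horner (c ∷ p) x = c + x * horner p x

coef : List ℚ → Seq
coef []      m       = 0ℚ
coef (c ∷ p) zero    = c
coef (c ∷ p) (suc m) = coef p m

coef-zero⇒horner-zero : ∀ p → (∀ m → coef p m ≡ 0ℚ) → ∀ x → horner p x ≡ 0ℚ
coef-zero⇒horner-zero []      z x = refl
coef-zero⇒horner-zero (c ∷ p) z x = trans
  (cong₂ (λ u v → u + x * v) (z 0) (coef-zero⇒horner-zero p (z ∘ suc) x))
  (trans (+-identityˡ (x * 0ℚ)) (*-zeroʳ x))

-- Represents (v + 2) p(2x) - p(x), whose coefficients are those of p multiplied by (v + 2) 2^m - 1 > 0.
dilate : ℕ → List ℚ → List ℚ
dilate v []      = []
dilate v (c ∷ p) = ιℕ (suc v) * c ∷ dilate (suc (suc (v ℕ.+ v))) p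

length-dilate : ∀ v p → length (dilate v p) ≡ length p
length-dilate v []      = refl
length-dilate v (c ∷ p) = cong suc (length-dilate _ p)

-- Splitting off the constant coefficient leaves a tail multiplied by 2x in p(2x) and by x in p(x).
-- The factor v + 2 thus becomes 2 (v + 2) = (2v + 2) + 2, which explains the parameter of the
-- recursive call.
horner-dilate : ∀ v p x → horner (dilate v p) x ≡ ιℕ (suc (suc v)) * horner p (ιℕ 2 * x) - horner p x
horner-dilate v []      x = sym (trans (+-identityʳ _) (*-zeroʳ (ιℕ (suc (suc v)))))
horner-dilate v (c ∷ p) x = begin
  ιℕ (suc v) * c + x * horner (dilate (suc (suc (v ℕ.+ v))) p) x
    ≡⟨ cong (λ z → ιℕ (suc v) * c + x * z) (horner-dilate _ p x) ⟩
  ιℕ (suc v) * c + x * (ιℕ (4 ℕ.+ (v ℕ.+ v)) * h₂ - h₁)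
    ≡⟨ cong₂ (λ y z → y * c + x * (z * h₂ - h₁)) (ιℕ-suc v)
         (trans (ιℕ-+ 4 (v ℕ.+ v)) (cong (ιℕ 4 +_) (ιℕ-+ v v))) ⟩
  (1ℚ + ιℕ v) * c + x * ((ιℕ 4 + (ιℕ v + ιℕ v)) * h₂ - h₁)
    ≡⟨ solve 5 (λ v c x h₁ h₂ → (con 1ℚ :+ v) :* c :+ x :* ((con (ιℕ 4) :+ (v :+ v)) :* h₂ :- h₁)
                 := (con (ιℕ 2) :+ v) :* (c :+ con (ιℕ 2) :* x :* h₂) :- (c :+ x :* h₁)) refl (ιℕ v) c x h₁ h₂ ⟩
  (ιℕ 2 + ιℕ v) * (c + ιℕ 2 * x * h₂) - (c + x * h₁)
    ≡⟨ cong (λ z → z * (c + ιℕ 2 * x * h₂) - (c + x * h₁)) (ιℕ-+ 2 v) ⟨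
  ιℕ (suc (suc v)) * (c + ιℕ 2 * x * h₂) - (c + x * h₁) ∎
  where
  h₁ = horner p x
  h₂ = horner p (ιℕ 2 * x)

coef-dilate-zero : ∀ v p → (∀ m → coef (dilate v p) m ≡ 0ℚ) → ∀ m → coef p m ≡ 0ℚ
coef-dilate-zero v []      z m       = refl
coef-dilate-zero v (c ∷ p) z zero    = ιℕ-*-zero (suc v) (z 0)
coef-dilate-zero v (c ∷ p) z (suc m) = coef-dilate-zero _ p (z ∘ suc) m

-- p(2x) - p(x) is x times a polynomial of smaller degree with the same vanishing property.
horner-zero⇒coef-zero : ∀ N p → length p ≤ N → (∀ x → x ≢ 0ℚ → horner p x ≡ 0ℚ) → ∀ m → coef p m ≡ 0ℚ
horner-zero⇒coef-zero N       []      _       z m = refl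
horner-zero⇒coef-zero (suc N) (c ∷ p) (s≤s l) z = coefs
  where
  double≢0 : ∀ {x} → x ≢ 0ℚ → ιℕ 2 * x ≢ 0ℚ
  double≢0 x≢0 eq = x≢0 (ιℕ-*-zero 2 eq)
  tail-zero : ∀ m → coef p m ≡ 0ℚ
  tail-zero = coef-dilate-zero 0 p (horner-zero⇒coef-zero N (dilate 0 p)
    (ℕ.≤-trans (ℕ.≤-reflexive (length-dilate 0 p)) l)
    (λ x x≢0 → *-zero-cancelˡ x≢0 (begin
      x * horner (dilate 0 p) x
        ≡⟨ cong (x *_) (horner-dilate 0 p x) ⟩
      x * (ιℕ 2 * horner p (ιℕ 2 * x) - horner p x)
        ≡⟨ solve 4 (λ c x h₁ h₂ → x :* (con (ιℕ 2) :* h₂ :- h₁)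
                      := c :+ con (ιℕ 2) :* x :* h₂ :- (c :+ x :* h₁)) refl c x (horner p x) (horner p (ιℕ 2 * x)) ⟩
      horner (c ∷ p) (ιℕ 2 * x) - horner (c ∷ p) x
        ≡⟨ cong₂ _-_ (z _ (double≢0 x≢0)) (z x x≢0) ⟩
      0ℚ ∎)))
  coefs : ∀ m → coef (c ∷ p) m ≡ 0ℚ
  -- The constant term is read off at 1 instead of 0, since vanishing is assumed only away from 0.
  coefs zero    = begin
    c                     ≡⟨ solve 1 (λ c → c := c :+ con 1ℚ :* con 0ℚ) refl c ⟩
    c + 1ℚ * 0ℚ           ≡⟨ cong (λ h → c + 1ℚ * h) (coef-zero⇒horner-zero p tail-zero 1ℚ) ⟨
    c + 1ℚ * horner p 1ℚ  ≡⟨ z 1ℚ (λ ()) ⟩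
    0ℚ                    ∎
  coefs (suc m) = tail-zero m

-- The list only certifies that f and c belong together. With coefficients as a sequence, products
-- are given by `conv` and trailing zeros of the list do not matter.
IsPolynomial : (ℚ → ℚ) → Seq → Set
IsPolynomial f c = Σ (List ℚ) λ p → (∀ x → horner p x ≡ f x) × (∀ m → coef p m ≡ c m)

poly-cong : ∀ {f f′ c c′} → (∀ x → f x ≡ f′ x) → c ≗ₛ c′ → IsPolynomial f c → IsPolynomial f′ c′
poly-cong p q (l , h , k) = l , (λ x → trans (h x) (p x)) , (λ m → trans (k m) (q m))

poly-zero : ∀ {f c} → IsPolynomial f c → (∀ x → f x ≡ 0ℚ) → ∀ m → c m ≡ 0ℚ
poly-zero (l , h , k) z m =
  trans (sym (k m)) (horner-zero⇒coef-zero (length l) l ℕ.≤-refl (λ x _ → trans (h x) (z x)) m)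

poly-at-0 : ∀ {f c} → IsPolynomial f c → f 0ℚ ≡ c 0
poly-at-0 {f} (l , h , k) = trans (sym (h 0ℚ)) (trans (horner-0 l) (k 0))
  where
  horner-0 : ∀ p → horner p 0ℚ ≡ coef p 0
  horner-0 []      = refl
  horner-0 (c ∷ p) = trans (cong (c +_) (*-zeroˡ (horner p 0ℚ))) (+-identityʳ c)

poly-0 : IsPolynomial (λ _ → 0ℚ) (λ _ → 0ℚ)
poly-0 = [] , (λ _ → refl) , (λ _ → refl)

poly-1 : IsPolynomial (λ _ → 1ℚ) (δ 0)
poly-1 = 1ℚ ∷ [] , (λ x → trans (cong (1ℚ +_) (*-zeroʳ x)) (+-identityʳ 1ℚ)) , λ { zero → refl ; (suc m) → refl }

poly-scale : ∀ {f c} y → IsPolynomial f c → IsPolynomial (λ x → y * f x) (λ m → y * c m)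
poly-scale {f} {c} y (l , h , k) = map (y *_) l
  , (λ x → trans (horner-map l x) (cong (y *_) (h x)))
  , (λ m → trans (coef-map l m) (cong (y *_) (k m)))
  where
  horner-map : ∀ p x → horner (map (y *_) p) x ≡ y * horner p x
  horner-map []      x = sym (*-zeroʳ y)
  horner-map (c ∷ p) x = trans (cong (λ z → y * c + x * z) (horner-map p x))
    (solve 4 (λ y c x h → y :* c :+ x :* (y :* h) := y :* (c :+ x :* h)) refl y c x (horner p x))
  coef-map : ∀ p m → coef (map (y *_) p) m ≡ y * coef p m
  coef-map []      m       = sym (*-zeroʳ y)
  coef-map (c ∷ p) zero    = refl
  coef-map (c ∷ p) (suc m) = coef-map p m

poly-+ : ∀ {f g c d} → IsPolynomial f c → IsPolynomial g d → IsPolynomial (λ x → f x + g x) (λ m → c m + d m)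
poly-+ (l , h , k) (l′ , h′ , k′) = add l l′
  , (λ x → trans (horner-add l l′ x) (cong₂ _+_ (h x) (h′ x)))
  , (λ m → trans (coef-add l l′ m) (cong₂ _+_ (k m) (k′ m)))
  where
  add : List ℚ → List ℚ → List ℚ
  add []      q       = q
  add (a ∷ p) []      = a ∷ p
  add (a ∷ p) (b ∷ q) = a + b ∷ add p q
  horner-add : ∀ p q x → horner (add p q) x ≡ horner p x + horner q x
  horner-add []      q       x = sym (+-identityˡ (horner q x))
  horner-add (a ∷ p) []      x = sym (+-identityʳ (a + x * horner p x))
  horner-add (a ∷ p) (b ∷ q) x = trans (cong (λ z → a + b + x * z) (horner-add p q x))
    (solve 5 (λ a b x u v → a :+ b :+ x :* (u :+ v) := a :+ x :* u :+ (b :+ x :* v)) refl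
      a b x (horner p x) (horner q x))
  coef-add : ∀ p q m → coef (add p q) m ≡ coef p m + coef q m
  coef-add []      q       m       = sym (+-identityˡ (coef q m))
  coef-add (a ∷ p) []      m       = sym (+-identityʳ (coef (a ∷ p) m))
  coef-add (a ∷ p) (b ∷ q) zero    = refl
  coef-add (a ∷ p) (b ∷ q) (suc m) = coef-add p q m

poly-X : ∀ {f c} → IsPolynomial f c → IsPolynomial (λ x → x * f x) (conv (δ 1) c)
poly-X {c = c} (l , h , k) = 0ℚ ∷ l
  , (λ x → trans (+-identityˡ (x * horner l x)) (cong (x *_) (h x)))
  , λ { zero → sym (conv-δ-zero 0 c) ; (suc m) → trans (k m) (sym (trans (conv-δ-suc 0 c m) (conv-δ0 c m))) }

poly-pow : ∀ j {f c} → IsPolynomial f c → IsPolynomial (λ x → powQ x j * f x) (conv (δ j) c)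
poly-pow zero    {f} {c} p = poly-cong (λ x → sym (*-identityˡ (f x))) (λ m → sym (conv-δ0 c m)) p
poly-pow (suc j) {f} {c} p = poly-cong (λ x → sym (*-assoc x (powQ x j) (f x))) shift (poly-X (poly-pow j p))
  where
  shift : conv (δ 1) (conv (δ j) c) ≗ₛ conv (δ (suc j)) c
  shift zero    = trans (conv-δ-zero 0 (conv (δ j) c)) (sym (conv-δ-zero j c))
  shift (suc m) = trans (conv-δ-suc 0 (conv (δ j) c) m) (trans (conv-δ0 (conv (δ j) c) m) (sym (conv-δ-suc j c m)))

-- Coefficients in x of x^(d i) + t_i. The degrees d are arbitrary because recursion over exponent
-- vectors shifts their index. The case of interest is d = `suc`: adjoining x to A adds x^(i+1) to
-- the power sum of index i + 1.
binomial : (ℕ → ℕ) → (ℕ → ℚ) → ℕ → Seq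
binomial d t i m = δ (d i) m + t i * δ 0 m

poly-binomial : ∀ d t {f c} → IsPolynomial f c →
  IsPolynomial (λ x → (powQ x (d 0) + t 0) * f x) (conv (binomial d t 0) c)
poly-binomial d t {f} {c} p = poly-cong
  (λ x → sym (*-distribʳ-+ (f x) (powQ x (d 0)) (t 0)))
  (λ m → sym (trans (conv-distribʳ (δ (d 0)) (λ i → t 0 * δ 0 i) c m)
                    (cong (_+_ (conv (δ (d 0)) c m)) (trans (conv-scaleˡ (t 0) (δ 0) c m) (cong (t 0 *_) (conv-δ0 c m))))))
  (poly-+ (poly-pow (d 0) p) (poly-scale (t 0) p))

poly-convPow : ∀ d t e {f c} → IsPolynomial f c →
  IsPolynomial (λ x → powQ (powQ x (d 0) + t 0) e * f x) (convPow (binomial d t 0) e c)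
poly-convPow d t zero    {f} p = poly-cong (λ x → sym (*-identityˡ (f x))) (λ _ → refl) p
poly-convPow d t (suc e) {f} p = poly-cong
  (λ x → sym (*-assoc (powQ x (d 0) + t 0) (powQ (powQ x (d 0) + t 0) e) (f x))) (λ _ → refl)
  (poly-binomial d t (poly-convPow d t e p))

poly-evalMono : ∀ {K} d t (e : Vec ℕ K) →
  IsPolynomial (λ x → evalMono e (λ i → powQ x (d (toℕ i)) + t (toℕ i))) (convProd (binomial d t) (δ 0) e)
poly-evalMono d t []       = poly-1
poly-evalMono d t (e ∷ es) = poly-convPow d t e (poly-evalMono (d ∘ suc) (t ∘ suc) es)

-- Coefficients in x of R(t_1 + x, t_2 + x^2, ...). If t consists of the power sums of A, this
-- polynomial in x is R at the power sums of `x ∷ A`.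
shiftCoef : ∀ {K} → Poly K → (ℕ → ℚ) → Seq
shiftCoef []            t m = 0ℚ
shiftCoef ((c , e) ∷ R) t m = c * convProd (binomial suc t) (δ 0) e m + shiftCoef R t m

poly-evalPoly : ∀ {K} (R : Poly K) t →
  IsPolynomial (λ x → evalPoly R (λ i → powQ x (suc (toℕ i)) + t (toℕ i))) (shiftCoef R t)
poly-evalPoly []            t = poly-0
poly-evalPoly ((c , e) ∷ R) t = poly-+ (poly-scale c (poly-evalMono suc t e)) (poly-evalPoly R t)

evalMono-cong : ∀ {K} (e : Vec ℕ K) {t u} → (∀ i → t i ≡ u i) → evalMono e t ≡ evalMono e u
evalMono-cong []       p = refl
evalMono-cong (e ∷ es) p = cong₂ _*_ (cong (λ x → powQ x e) (p zero)) (evalMono-cong es (p ∘ suc))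

evalPoly-cong : ∀ {K} (R : Poly K) {t u} → (∀ i → t i ≡ u i) → evalPoly R t ≡ evalPoly R u
evalPoly-cong []            p = refl
evalPoly-cong ((c , e) ∷ R) p = cong₂ (λ x y → c * x + y) (evalMono-cong e p) (evalPoly-cong R p)

shiftCoef-0 : ∀ {K} (R : Poly K) t → shiftCoef R t 0 ≡ evalPoly R (t ∘ toℕ)
shiftCoef-0 R t = trans (sym (poly-at-0 (poly-evalPoly R t))) (evalPoly-cong R (λ i →
  trans (cong (_+ t (toℕ i)) (*-zeroˡ (powQ 0ℚ (toℕ i)))) (+-identityˡ (t (toℕ i)))))

-- Uniqueness: power sums of n numbers satisfy no relation of weight at most n

-- The partial derivative in t_(i+1). Terms free of this variable stay in the list with coefficient
-- 0.
∂ : ∀ {K} → ℕ → Poly K → Poly K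
∂ i = map (λ (c , e) → c * ιℕ (at e i) , dec e i)

θ-binomial : ∀ t i → θ (binomial suc t i) ≗ₛ (λ m → ιℕ (suc i) * δ (suc i) m)
θ-binomial t i m = begin
  ιℕ m * (δ (suc i) m + t i * δ 0 m)
    ≡⟨ solve 4 (λ n x t y → n :* (x :+ t :* y) := n :* x :+ t :* (n :* y)) refl (ιℕ m) (δ (suc i) m) (t i) (δ 0 m) ⟩
  θ (δ (suc i)) m + t i * θ (δ 0) m
    ≡⟨ cong₂ (λ x y → x + t i * y) (θ-δ (suc i) m) (trans (θ-δ 0 m) (*-zeroˡ (δ 0 m))) ⟩
  ιℕ (suc i) * δ (suc i) m + t i * 0ℚ
    ≡⟨ trans (cong (_+_ (ιℕ (suc i) * δ (suc i) m)) (*-zeroʳ (t i))) (+-identityʳ _) ⟩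
  ιℕ (suc i) * δ (suc i) m ∎

-- Coefficient form of x d/dx R(t + x^•) = Σ_i (i + 1) x^(i + 1) (∂_i R)(t + x^•), an analogue of Newton's identities.
θ-shiftCoef : ∀ {K} (R : Poly K) t j → θ (shiftCoef R t) j ≡
  Σ< K (λ i → ιℕ (suc i) * conv (δ (suc i)) (shiftCoef (∂ i R) t) j)
θ-shiftCoef {K} []            t j = trans (*-zeroʳ (ιℕ j)) (sym (Σ<-zero K _ (λ i →
  trans (cong (ιℕ (suc i) *_) (conv-zeroʳ (δ (suc i)) j)) (*-zeroʳ (ιℕ (suc i))))))
θ-shiftCoef {K} ((c , e) ∷ R) t j = begin
  ιℕ j * (c * γ e j + shiftCoef R t j)
    ≡⟨ solve 4 (λ n c x y → n :* (c :* x :+ y) := c :* (n :* x) :+ n :* y) refl (ιℕ j) c (γ e j) (shiftCoef R t j) ⟩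
  c * θ (γ e) j + θ (shiftCoef R t) j
    ≡⟨ cong₂ (λ x y → c * x + y) (θ-convProd (binomial suc t) (δ 0) e (λ m → trans (θ-δ 0 m) (*-zeroˡ (δ 0 m))) j)
         (θ-shiftCoef R t j) ⟩
  c * Σ< K (λ i → ιℕ (at e i) * conv (θ (binomial suc t i)) (γ (dec e i)) j)
    + Σ< K (λ i → ιℕ (suc i) * conv (δ (suc i)) (shiftCoef (∂ i R) t) j)
    ≡⟨ cong (_+ Σ< K (λ i → ιℕ (suc i) * conv (δ (suc i)) (shiftCoef (∂ i R) t) j)) (*-Σ< K c _) ⟩
  Σ< K (λ i → c * (ιℕ (at e i) * conv (θ (binomial suc t i)) (γ (dec e i)) j))
    + Σ< K (λ i → ιℕ (suc i) * conv (δ (suc i)) (shiftCoef (∂ i R) t) j)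
    ≡⟨ Σ<-+ K _ _ ⟨
  Σ< K (λ i → c * (ιℕ (at e i) * conv (θ (binomial suc t i)) (γ (dec e i)) j)
    + ιℕ (suc i) * conv (δ (suc i)) (shiftCoef (∂ i R) t) j)
    ≡⟨ Σ<-cong K term ⟩
  Σ< K (λ i → ιℕ (suc i) * conv (δ (suc i)) (shiftCoef (∂ i ((c , e) ∷ R)) t) j) ∎
  where
  γ : Vec ℕ K → Seq
  γ = convProd (binomial suc t) (δ 0)
  term : ∀ i → _
  term i = begin
    c * (ιℕ (at e i) * conv (θ (binomial suc t i)) (γ (dec e i)) j) + ιℕ (suc i) * y
      ≡⟨ cong (λ z → c * (ιℕ (at e i) * z) + ιℕ (suc i) * y)
           (trans (conv-cong (θ-binomial t i) (λ _ → refl) j) (conv-scaleˡ (ιℕ (suc i)) (δ (suc i)) (γ (dec e i)) j)) ⟩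
    c * (ιℕ (at e i) * (ιℕ (suc i) * x)) + ιℕ (suc i) * y
      ≡⟨ solve 5 (λ c a s x y → c :* (a :* (s :* x)) :+ s :* y := s :* (c :* a :* x :+ y)) refl
           c (ιℕ (at e i)) (ιℕ (suc i)) x y ⟩
    ιℕ (suc i) * (c * ιℕ (at e i) * x + y)
      ≡⟨ cong (λ z → ιℕ (suc i) * (z + y)) (conv-scaleʳ (c * ιℕ (at e i)) (δ (suc i)) (γ (dec e i)) j) ⟨
    ιℕ (suc i) * (conv (δ (suc i)) (λ m → c * ιℕ (at e i) * γ (dec e i) m) j + y)
      ≡⟨ cong (ιℕ (suc i) *_) (conv-distribˡ (δ (suc i)) _ _ j) ⟨
    ιℕ (suc i) * conv (δ (suc i)) (shiftCoef (∂ i ((c , e) ∷ R)) t) j ∎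
    where
    x = conv (δ (suc i)) (γ (dec e i)) j
    y = conv (δ (suc i)) (shiftCoef (∂ i R) t) j
powerSums : List ℚ → ℕ → ℚ
powerSums A i = powerSum (suc i) A

-- All lengths up to n are included so that the empty list is always among them;
-- `vanishes-from-length` obtains this from length exactly n by padding with zeros.
VanishesUpTo : ∀ {K} → ℕ → Poly K → Set
VanishesUpTo n R = ∀ A → length A ≤ n → evalPoly R (powerSums A ∘ toℕ) ≡ 0ℚ

vanishes-shiftCoef : ∀ {K n} (R : Poly K) → VanishesUpTo (suc n) R →
  ∀ A → length A ≤ n → ∀ m → shiftCoef R (powerSums A) m ≡ 0ℚ
vanishes-shiftCoef R v A l = poly-zero (poly-evalPoly R (powerSums A)) (λ x → v (x ∷ A) (s≤s l))

vanishes-mono : ∀ {K m n} (R : Poly K) → m ≤ n → VanishesUpTo n R → VanishesUpTo m R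
vanishes-mono R m≤n v A l = v A (ℕ.≤-trans l m≤n)

-- The loss of j + 1 elements equals the weight of t_(j+1). A predicate of j is needed for
-- well-founded induction, since all ∂_i with i < j enter the same coefficient of x.
∂-Vanishes : ℕ → ℕ → Set
∂-Vanishes K j = j < K → ∀ n (R : Poly K) → VanishesUpTo (suc j ℕ.+ n) R → VanishesUpTo n (∂ j R)

-- Adjoining one number x to A and comparing coefficients of x^(j + 1): all terms except that of ∂_j drop out.
vanishes-∂ : ∀ {K} j → ∂-Vanishes K j
vanishes-∂ {K} = <-rec (∂-Vanishes K) step
  where
  step : ∀ j → (∀ {i} → i < j → ∂-Vanishes K i) → ∂-Vanishes K j
  step j ih j<K n R v A l = trans (sym (shiftCoef-0 (∂ j R) t)) (ιℕ-*-zero (suc j) (begin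
    ιℕ (suc j) * shiftCoef (∂ j R) t 0
      ≡⟨ cong (ιℕ (suc j) *_) (conv-δ-self (suc j) (shiftCoef (∂ j R) t)) ⟨
    summand j
      ≡⟨ Σ<-single K summand j j<K other ⟨
    Σ< K summand
      ≡⟨ θ-shiftCoef R t (suc j) ⟨
    ιℕ (suc j) * shiftCoef R t (suc j)
      ≡⟨ cong (ιℕ (suc j) *_) (vanishes-shiftCoef R v A (ℕ.≤-trans l (ℕ.m≤n+m n j)) (suc j)) ⟩
    ιℕ (suc j) * 0ℚ
      ≡⟨ *-zeroʳ (ιℕ (suc j)) ⟩
    0ℚ ∎))
    where
    t = powerSums A
    summand : ℕ → ℚ
    summand i = ιℕ (suc i) * conv (δ (suc i)) (shiftCoef (∂ i R) t) (suc j)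
    times-zero : ∀ i {x} → x ≡ 0ℚ → ιℕ (suc i) * x ≡ 0ℚ
    times-zero i eq = trans (cong (ιℕ (suc i) *_) eq) (*-zeroʳ (ιℕ (suc i)))
    other : ∀ i → i ≢ j → summand i ≡ 0ℚ
    other i i≢j with ℕ.<-cmp i j
    -- For i < j the term contains the coefficient of x^(j-i) in the values of ∂_i R on `x ∷ A`. It
    -- vanishes if ∂_i R vanishes up to n + 1 elements, which is affordable because i + 1 + (n + 1)
    -- ≤ j + 1 + n.
    ... | tri< i<j _ _ = times-zero i (trans
            (conv-cong {δ (suc i)} (λ _ → refl) (vanishes-shiftCoef (∂ i R)
              (ih i<j (ℕ.<-trans i<j j<K) (suc n) R (vanishes-mono R bound v)) A l) (suc j))
            (conv-zeroʳ (δ (suc i)) (suc j)))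
      where
      bound : suc i ℕ.+ suc n ≤ suc j ℕ.+ n
      bound = ℕ.≤-trans (ℕ.≤-reflexive (ℕ.+-suc (suc i) n)) (s≤s (ℕ.+-monoˡ-≤ n i<j))
    ... | tri≈ _ i≡j _ = contradiction i≡j i≢j
    -- The factor x^(i+1) already has degree above j + 1.
    ... | tri> _ _ j<i = times-zero i (conv-δ-< (shiftCoef (∂ i R) t) (s≤s j<i))

-- Entry i stands for the variable t_(o + i + 1).
weightFrom : ∀ {K} → ℕ → Vec ℕ K → ℕ
weightFrom o []       = 0
weightFrom o (e ∷ es) = e ℕ.* suc o ℕ.+ weightFrom (suc o) es

weight : ∀ {K} → Vec ℕ K → ℕ
weight = weightFrom 0

weightFrom-dec : ∀ {K} o (e : Vec ℕ K) i {m} → at e i ≡ suc m →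
  weightFrom o e ≡ suc (o ℕ.+ i) ℕ.+ weightFrom o (dec e i)
weightFrom-dec o (suc e ∷ es) zero    eq = trans (ℕ.+-assoc (suc o) (e ℕ.* suc o) (weightFrom (suc o) es))
  (cong (λ z → suc z ℕ.+ (e ℕ.* suc o ℕ.+ weightFrom (suc o) es)) (sym (ℕ.+-identityʳ o)))
weightFrom-dec o (e ∷ es)     (suc i) eq = begin
  e ℕ.* suc o ℕ.+ weightFrom (suc o) es
    ≡⟨ cong (e ℕ.* suc o ℕ.+_) (weightFrom-dec (suc o) es i eq) ⟩
  e ℕ.* suc o ℕ.+ (suc (suc o ℕ.+ i) ℕ.+ w)
    ≡⟨ ℕ.+-assoc (e ℕ.* suc o) (suc (suc o ℕ.+ i)) w ⟨
  e ℕ.* suc o ℕ.+ suc (suc o ℕ.+ i) ℕ.+ w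
    ≡⟨ cong (ℕ._+ w) (ℕ.+-comm (e ℕ.* suc o) (suc (suc o ℕ.+ i))) ⟩
  suc (suc o ℕ.+ i) ℕ.+ e ℕ.* suc o ℕ.+ w
    ≡⟨ ℕ.+-assoc (suc (suc o ℕ.+ i)) (e ℕ.* suc o) w ⟩
  suc (suc o ℕ.+ i) ℕ.+ (e ℕ.* suc o ℕ.+ w)
    ≡⟨ cong (λ z → suc z ℕ.+ (e ℕ.* suc o ℕ.+ w)) (sym (ℕ.+-suc o i)) ⟩
  suc (o ℕ.+ suc i) ℕ.+ (e ℕ.* suc o ℕ.+ w) ∎
  where w = weightFrom (suc o) (dec es i)

weight-dec : ∀ {K} (e : Vec ℕ K) i {m} → at e i ≡ suc m → weight e ≡ suc i ℕ.+ weight (dec e i)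
weight-dec = weightFrom-dec 0

zeros : ∀ {K} → Vec ℕ K
zeros = Vec.replicate _ 0

zeros-or-positive : ∀ {K} (e : Vec ℕ K) → e ≡ zeros ⊎ Σ ℕ λ i → Σ ℕ λ m → i < K × at e i ≡ suc m
zeros-or-positive []           = inj₁ refl
zeros-or-positive (suc e ∷ es) = inj₂ (0 , e , s≤s z≤n , refl)
zeros-or-positive (zero ∷ es) with zeros-or-positive es
... | inj₁ eq                = inj₁ (cong (0 ∷_) eq)
... | inj₂ (i , m , i<K , p) = inj₂ (suc i , m , s≤s i<K , p)

evalMono-zeros : ∀ {K} t → evalMono (zeros {K}) t ≡ 1ℚ
evalMono-zeros {zero}  t = refl
evalMono-zeros {suc K} t = trans (*-identityˡ (evalMono (zeros {K}) (t ∘ suc))) (evalMono-zeros {K} (t ∘ suc))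

evalMono-at-0 : ∀ {K} (e : Vec ℕ K) → e ≢ zeros → evalMono e (λ _ → 0ℚ) ≡ 0ℚ
evalMono-at-0 []           e≢0 = contradiction refl e≢0
evalMono-at-0 (zero ∷ es)  e≢0 = trans (*-identityˡ (evalMono es (λ _ → 0ℚ))) (evalMono-at-0 es (λ eq → e≢0 (cong (0 ∷_) eq)))
evalMono-at-0 (suc e ∷ es) e≢0 = trans (cong (_* evalMono es (λ _ → 0ℚ)) (*-zeroˡ (powQ 0ℚ e))) (*-zeroˡ (evalMono es (λ _ → 0ℚ)))

coeff-zeros : ∀ {K} (R : Poly K) → coeff R zeros ≡ evalPoly R (λ _ → 0ℚ)
coeff-zeros []            = refl
coeff-zeros {K} ((c , e) ∷ R) with Vec.≡-dec ℕ._≟_ e zeros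
... | yes refl = cong₂ _+_ (sym (trans (cong (c *_) (evalMono-zeros {K} (λ _ → 0ℚ))) (*-identityʳ c))) (coeff-zeros R)
... | no  e≢0  = trans (coeff-zeros R) (sym (trans
        (cong (_+ evalPoly R (λ _ → 0ℚ)) (trans (cong (c *_) (evalMono-at-0 e e≢0)) (*-zeroʳ c)))
        (+-identityˡ (evalPoly R (λ _ → 0ℚ)))))

dec-injective : ∀ {K} (e e′ : Vec ℕ K) i {m m′} → at e i ≡ suc m → at e′ i ≡ suc m′ → dec e i ≡ dec e′ i → e ≡ e′
dec-injective (suc e ∷ es) (suc e′ ∷ es′) zero    p q refl = refl
dec-injective (e ∷ es)     (e′ ∷ es′)     (suc i) p q eq   =
  cong₂ _∷_ (Vec.∷-injectiveˡ eq) (dec-injective es es′ i p q (Vec.∷-injectiveʳ eq))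

-- `dec` identifies a vector with entry 1 at i with the one having entry 0 there, so different
-- monomials of R can land on the same one. The intruders have entry 0 and therefore carry the
-- factor 0.
coeff-∂ : ∀ {K} (R : Poly K) e i {m} → at e i ≡ suc m → coeff (∂ i R) (dec e i) ≡ ιℕ (at e i) * coeff R e
coeff-∂ []             e i p = sym (*-zeroʳ (ιℕ (at e i)))
coeff-∂ ((c , e′) ∷ R) e i p with Vec.≡-dec ℕ._≟_ (dec e′ i) (dec e i) | Vec.≡-dec ℕ._≟_ e′ e
... | yes _   | yes refl = trans (cong₂ _+_ (*-comm c (ιℕ (at e i))) (coeff-∂ R e i p))
                             (sym (*-distribˡ-+ (ιℕ (at e i)) c (coeff R e)))
... | no  d≢  | yes refl = contradiction refl d≢
... | no  _   | no  _    = coeff-∂ R e i p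
... | yes d≡  | no  e′≢e with at e′ i in q
...   | zero  = trans (cong (_+ coeff (∂ i R) (dec e i)) (*-zeroʳ c))
                  (trans (+-identityˡ (coeff (∂ i R) (dec e i))) (coeff-∂ R e i p))
...   | suc _ = contradiction (dec-injective e′ e i q p d≡) e′≢e

-- Differentiating by a variable that occurs in e multiplies the coefficient by a positive integer,
-- and lowers the weight by exactly the number of elements that `vanishes-∂` gives up.
vanishes⇒coeff-zero : ∀ {K} n (R : Poly K) → VanishesUpTo n R → ∀ e → weight e ≤ n → coeff R e ≡ 0ℚ
vanishes⇒coeff-zero {K} = <-rec Claim step
  where
  Claim : ℕ → Set
  Claim n = ∀ (R : Poly K) → VanishesUpTo n R → ∀ e → weight e ≤ n → coeff R e ≡ 0ℚ
  step : ∀ n → (∀ {m} → m < n → Claim m) → Claim n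
  step n ih R v e w≤n with zeros-or-positive e
  ... | inj₁ refl = trans (coeff-zeros R) (v [] z≤n)
  ... | inj₂ (i , m , i<K , p) = ιℕ-*-zero (suc m) (trans (cong (λ z → ιℕ z * coeff R e) (sym p))
          (trans (sym (coeff-∂ R e i p))
                 (ih below (∂ i R) (vanishes-∂ i i<K (weight (dec e i)) R (vanishes-mono R bound v)) (dec e i) ℕ.≤-refl)))
    where
    bound : suc i ℕ.+ weight (dec e i) ≤ n
    bound = ℕ.≤-trans (ℕ.≤-reflexive (sym (weight-dec e i p))) w≤n
    below : weight (dec e i) < n
    below = ℕ.≤-trans (s≤s (ℕ.m≤n+m (weight (dec e i)) i)) bound

-- Added zeros are invisible to power sums of positive index; 𝔭_0 would count them.
powerSum-pad : ∀ d A i → powerSums (List.replicate d 0ℚ ++ A) i ≡ powerSums A i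
powerSum-pad zero    A i = refl
powerSum-pad (suc d) A i = trans
  (cong₂ _+_ (*-zeroˡ (powQ 0ℚ i)) (powerSum-pad d A i)) (+-identityˡ (powerSums A i))

vanishes-from-length : ∀ {K} n (R : Poly K) →
  (∀ A → length A ≡ n → evalPoly R (powerSums A ∘ toℕ) ≡ 0ℚ) → VanishesUpTo n R
vanishes-from-length n R v A l = trans
  (evalPoly-cong R (λ i → sym (powerSum-pad (n ∸ length A) A (toℕ i))))
  (v (List.replicate (n ∸ length A) 0ℚ ++ A) (begin
    length (List.replicate (n ∸ length A) 0ℚ ++ A)
      ≡⟨ List.length-++ (List.replicate (n ∸ length A) 0ℚ) ⟩
    length (List.replicate (n ∸ length A) 0ℚ) ℕ.+ length A
      ≡⟨ cong (ℕ._+ length A) (List.length-replicate (n ∸ length A)) ⟩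
    n ∸ length A ℕ.+ length A
      ≡⟨ ℕ.m∸n+n≡m l ⟩
    n ∎))

coeff-++ : ∀ {K} (P R : Poly K) e → coeff (P ++ R) e ≡ coeff P e + coeff R e
coeff-++ []             R e = sym (+-identityˡ (coeff R e))
coeff-++ ((c , e′) ∷ P) R e with Vec.≡-dec ℕ._≟_ e′ e
... | yes _ = trans (cong (c +_) (coeff-++ P R e)) (sym (+-assoc c (coeff P e) (coeff R e)))
... | no  _ = coeff-++ P R e

evalPoly-++ : ∀ {K} (P R : Poly K) t → evalPoly (P ++ R) t ≡ evalPoly P t + evalPoly R t
evalPoly-++ []            R t = sym (+-identityˡ (evalPoly R t))
evalPoly-++ ((c , e) ∷ P) R t = trans (cong (_+_ (c * evalMono e t)) (evalPoly-++ P R t))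
  (sym (+-assoc (c * evalMono e t) (evalPoly P t) (evalPoly R t)))

scalePoly : ∀ {K} → ℚ → Poly K → Poly K
scalePoly y = map (λ (c , e) → y * c , e)

coeff-scale : ∀ {K} y (P : Poly K) e → coeff (scalePoly y P) e ≡ y * coeff P e
coeff-scale y []             e = sym (*-zeroʳ y)
coeff-scale y ((c , e′) ∷ P) e with Vec.≡-dec ℕ._≟_ e′ e
... | yes _ = trans (cong (_+_ (y * c)) (coeff-scale y P e)) (sym (*-distribˡ-+ y c (coeff P e)))
... | no  _ = coeff-scale y P e

evalPoly-scale : ∀ {K} y (P : Poly K) t → evalPoly (scalePoly y P) t ≡ y * evalPoly P t
evalPoly-scale y []            t = sym (*-zeroʳ y)
evalPoly-scale y ((c , e) ∷ P) t = trans (cong (_+_ (y * c * evalMono e t)) (evalPoly-scale y P t))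
  (solve 4 (λ y c x z → y :* c :* x :+ y :* z := y :* (c :* x :+ z)) refl y c (evalMono e t) (evalPoly P t))

coeff-unique : ∀ {K} n (P R : Poly K) →
  (∀ A → length A ≡ n → evalPoly P (powerSums A ∘ toℕ) ≡ evalPoly R (powerSums A ∘ toℕ)) →
  ∀ e → weight e ≤ n → coeff P e ≡ coeff R e
coeff-unique n P R eq e w≤n = begin
  coeff P e
    ≡⟨ solve 2 (λ x y → x := x :+ con (- 1ℚ) :* y :+ y) refl (coeff P e) (coeff R e) ⟩
  coeff P e + - 1ℚ * coeff R e + coeff R e
    ≡⟨ cong (λ z → coeff P e + z + coeff R e) (coeff-scale (- 1ℚ) R e) ⟨
  coeff P e + coeff (scalePoly (- 1ℚ) R) e + coeff R e
    ≡⟨ cong (_+ coeff R e) (coeff-++ P (scalePoly (- 1ℚ) R) e) ⟨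
  coeff D e + coeff R e
    ≡⟨ cong (_+ coeff R e) (vanishes⇒coeff-zero n D (vanishes-from-length n D difference-zero) e w≤n) ⟩
  0ℚ + coeff R e
    ≡⟨ +-identityˡ (coeff R e) ⟩
  coeff R e ∎
  where
  D = P ++ scalePoly (- 1ℚ) R
  difference-zero : ∀ A → length A ≡ n → evalPoly D (powerSums A ∘ toℕ) ≡ 0ℚ
  difference-zero A l = trans (evalPoly-++ P (scalePoly (- 1ℚ) R) _) (trans
    (cong₂ _+_ (eq A l) (evalPoly-scale (- 1ℚ) R _))
    (solve 1 (λ x → x :+ con (- 1ℚ) :* x := con 0ℚ) refl (evalPoly R (powerSums A ∘ toℕ))))
-- Power sums of s-fold sums

∑ : ∀ {A : Set} → List A → (A → ℚ) → ℚ
∑ xs h = sumQ (map h xs)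

∑-cong : ∀ {A : Set} (xs : List A) {h h′} → (∀ x → h x ≡ h′ x) → ∑ xs h ≡ ∑ xs h′
∑-cong []       p = refl
∑-cong (x ∷ xs) p = cong₂ _+_ (p x) (∑-cong xs p)

∑-++ : ∀ {A : Set} (xs ys : List A) h → ∑ (xs ++ ys) h ≡ ∑ xs h + ∑ ys h
∑-++ []       ys h = sym (+-identityˡ (∑ ys h))
∑-++ (x ∷ xs) ys h = trans (cong (h x +_) (∑-++ xs ys h)) (sym (+-assoc (h x) (∑ xs h) (∑ ys h)))

∑-map : ∀ {A B : Set} (u : A → B) xs h → ∑ (map u xs) h ≡ ∑ xs (h ∘ u)
∑-map u []       h = refl
∑-map u (x ∷ xs) h = cong (h (u x) +_) (∑-map u xs h)

∑-scale : ∀ {A : Set} (xs : List A) y h → ∑ xs (λ x → y * h x) ≡ y * ∑ xs h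
∑-scale []       y h = sym (*-zeroʳ y)
∑-scale (x ∷ xs) y h = trans (cong (_+_ (y * h x)) (∑-scale xs y h)) (sym (*-distribˡ-+ y (h x) (∑ xs h)))

∑-+ : ∀ {A : Set} (xs : List A) h h′ → ∑ xs (λ x → h x + h′ x) ≡ ∑ xs h + ∑ xs h′
∑-+ []       h h′ = refl
∑-+ (x ∷ xs) h h′ = trans (cong (_+_ (h x + h′ x)) (∑-+ xs h h′))
  (solve 4 (λ x y u v → x :+ y :+ (u :+ v) := x :+ u :+ (y :+ v)) refl (h x) (h′ x) (∑ xs h) (∑ xs h′))

∑-Σ< : ∀ {A : Set} (xs : List A) N (F : A → ℕ → ℚ) → ∑ xs (λ x → Σ< N (F x)) ≡ Σ< N (λ i → ∑ xs (λ x → F x i))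
∑-Σ< []       N F = sym (Σ<-zero N _ (λ _ → refl))
∑-Σ< (x ∷ xs) N F = trans (cong (Σ< N (F x) +_) (∑-Σ< xs N F)) (sym (Σ<-+ N (F x) _))

conv-as-Σ< : ∀ a b k → conv a b k ≡ Σ< (suc k) (λ j → a j * b (k ∸ j))
conv-as-Σ< a b zero    = sym (+-identityʳ (a 0 * b 0))
conv-as-Σ< a b (suc k) = cong (_+_ (a 0 * b (suc k))) (conv-as-Σ< (a ∘ suc) b k)

-- x^k / k!, the coefficient of u^k in e^(xu). The recursive form makes the differentiation rule
-- `divPow-suc` immediate.
divPow : ℚ → ℕ → ℚ
divPow x zero    = 1ℚ
divPow x (suc k) = inv (suc k) * (x * divPow x k)

ιℕ-inv-cancel : ∀ n .{{_ : ℕ.NonZero n}} x → ιℕ n * (inv n * x) ≡ x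
ιℕ-inv-cancel n x = begin
  ιℕ n * (inv n * x)  ≡⟨ solve 3 (λ a b x → a :* (b :* x) := b :* a :* x) refl (ιℕ n) (inv n) x ⟩
  inv n * ιℕ n * x    ≡⟨ cong (_* x) (inv-inverse n) ⟩
  1ℚ * x              ≡⟨ *-identityˡ x ⟩
  x                   ∎

inv-ιℕ-cancel : ∀ n .{{_ : ℕ.NonZero n}} x → inv n * (ιℕ n * x) ≡ x
inv-ιℕ-cancel n x = trans (solve 3 (λ a b x → a :* (b :* x) := b :* (a :* x)) refl (inv n) (ιℕ n) x) (ιℕ-inv-cancel n x)

inv-* : ∀ m n .{{_ : ℕ.NonZero m}} .{{_ : ℕ.NonZero n}} → inv (m ℕ.* n) ≡ inv m * inv n
inv-* m n = ιℕ-cancel (m ℕ.* n) {{ℕ.m*n≢0 m n}} (begin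
  inv (m ℕ.* n) * ιℕ (m ℕ.* n)    ≡⟨ inv-inverse (m ℕ.* n) {{ℕ.m*n≢0 m n}} ⟩
  1ℚ                              ≡⟨ inv-inverse n ⟨
  inv n * ιℕ n                    ≡⟨ inv-ιℕ-cancel m (inv n * ιℕ n) ⟨
  inv m * (ιℕ m * (inv n * ιℕ n)) ≡⟨ solve 4 (λ a b c d → a :* (b :* (c :* d)) := a :* c :* (b :* d)) refl
                                       (inv m) (ιℕ m) (inv n) (ιℕ n) ⟩
  inv m * inv n * (ιℕ m * ιℕ n)   ≡⟨ cong (inv m * inv n *_) (ιℕ-* m n) ⟨
  inv m * inv n * ιℕ (m ℕ.* n)    ∎)

divPow-suc : ∀ x k → ιℕ (suc k) * divPow x (suc k) ≡ x * divPow x k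
divPow-suc x k = ιℕ-inv-cancel (suc k) (x * divPow x k)

divPow-powQ : ∀ x k → divPow x k ≡ inv (k !) * powQ x k
divPow-powQ x zero    = refl
divPow-powQ x (suc k) = begin
  inv (suc k) * (x * divPow x k)
    ≡⟨ cong (λ z → inv (suc k) * (x * z)) (divPow-powQ x k) ⟩
  inv (suc k) * (x * (inv (k !) * powQ x k))
    ≡⟨ solve 4 (λ a x b p → a :* (x :* (b :* p)) := a :* b :* (x :* p)) refl (inv (suc k)) x (inv (k !)) (powQ x k) ⟩
  inv (suc k) * inv (k !) * (x * powQ x k)
    ≡⟨ cong (_* (x * powQ x k)) (inv-* (suc k) (k !) {{_}} {{k ℕ.!≢0}}) ⟨
  inv (suc k !) * powQ x (suc k) ∎

divPow-scale : ∀ y x k → divPow (y * x) k ≡ powQ y k * divPow x k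
divPow-scale y x zero    = refl
divPow-scale y x (suc k) = trans (cong (λ z → inv (suc k) * (y * x * z)) (divPow-scale y x k))
  (solve 5 (λ a y x p d → a :* (y :* x :* (p :* d)) := y :* p :* (a :* (x :* d))) refl
    (inv (suc k)) y x (powQ y k) (divPow x k))

-- This is e^((x+y)u) = e^(xu) e^(yu). Both sides have u-derivative (x + y) times themselves, so
-- induction on k with the Leibniz rule suffices, without binomial coefficients.
divPow-+ : ∀ x y k → divPow (x + y) k ≡ conv (divPow x) (divPow y) k
divPow-+ x y zero    = refl
divPow-+ x y (suc k) = trans (cong (inv (suc k) *_) (sym euler)) (inv-ιℕ-cancel (suc k) (conv (divPow x) (divPow y) (suc k)))
  where
  D = conv (divPow x) (divPow y) k
  θ-divPow : ∀ x b → conv (θ (divPow x)) b (suc k) ≡ x * conv (divPow x) b k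
  θ-divPow x b = begin
    0ℚ * 1ℚ * b (suc k) + conv (λ i → θ (divPow x) (suc i)) b k
      ≡⟨ cong (0ℚ * 1ℚ * b (suc k) +_) (conv-cong (divPow-suc x) (λ _ → refl) k) ⟩
    0ℚ * 1ℚ * b (suc k) + conv (λ i → x * divPow x i) b k
      ≡⟨ cong (0ℚ * 1ℚ * b (suc k) +_) (conv-scaleˡ x (divPow x) b k) ⟩
    0ℚ * 1ℚ * b (suc k) + x * conv (divPow x) b k
      ≡⟨ solve 2 (λ b z → con 0ℚ :* con 1ℚ :* b :+ z := z) refl (b (suc k)) (x * conv (divPow x) b k) ⟩
    x * conv (divPow x) b k ∎
  euler : ιℕ (suc k) * conv (divPow x) (divPow y) (suc k) ≡ (x + y) * divPow (x + y) k
  euler = begin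
    ιℕ (suc k) * conv (divPow x) (divPow y) (suc k)
      ≡⟨ θ-conv (divPow x) (divPow y) (suc k) ⟩
    conv (θ (divPow x)) (divPow y) (suc k) + conv (divPow x) (θ (divPow y)) (suc k)
      ≡⟨ cong₂ _+_ (θ-divPow x (divPow y)) (trans (conv-comm (divPow x) (θ (divPow y)) (suc k))
           (trans (θ-divPow y (divPow x)) (cong (y *_) (conv-comm (divPow y) (divPow x) k)))) ⟩
    x * D + y * D
      ≡⟨ *-distribʳ-+ D x y ⟨
    (x + y) * D
      ≡⟨ cong ((x + y) *_) (divPow-+ x y k) ⟨
    (x + y) * divPow (x + y) k ∎

-- The summand h is a parameter because removing x from the front of A turns h into z ↦ h(x + z);
-- inductions over A therefore generalise over h.
Φ : ℕ → (ℚ → ℚ) → List ℚ → ℚ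
Φ s h A = ∑ (sSums s A) h

Φ-cons : ∀ s h x A → Φ (suc s) h (x ∷ A) ≡ Φ s (λ z → h (x + z)) A + Φ (suc s) h A
Φ-cons s h x A = trans (∑-++ (map (x +_) (sSums s A)) (sSums (suc s) A) h)
  (cong (_+ Φ (suc s) h A) (∑-map (x +_) (sSums s A) h))

-- Pairs of an element y of B and an r-element set of positions of A, with no disjointness required.
-- B is kept apart from A so that `pairSum-cons` can shorten A alone.
pairSum : ℕ → ℕ → (ℚ → ℚ) → List ℚ → List ℚ → ℚ
pairSum m r h B A = ∑ B (λ y → y * Φ r (λ z → h (ιℕ m * y + z)) A)

-- The part of pairSum m r h A A coming from the pairs of a position i and an r-element set of positions without i.
disjointSum : ℕ → ℕ → (ℚ → ℚ) → List ℚ → ℚ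
disjointSum m r       h []      = 0ℚ
disjointSum m zero    h (x ∷ A) = x * Φ 0 (λ z → h (ιℕ m * x + z)) A + disjointSum m zero h A
disjointSum m (suc r) h (x ∷ A) =
  x * Φ (suc r) (λ z → h (ιℕ m * x + z)) A + (disjointSum m r (λ z → h (x + z)) A + disjointSum m (suc r) h A)

pairSum-cons : ∀ m r h B x A →
  pairSum m (suc r) h B (x ∷ A) ≡ pairSum m r (λ z → h (x + z)) B A + pairSum m (suc r) h B A
pairSum-cons m r h B x A = trans (∑-cong B term) (∑-+ B _ _)
  where
  term : ∀ y → y * Φ (suc r) (λ z → h (ιℕ m * y + z)) (x ∷ A) ≡
    y * Φ r (λ z → h (x + (ιℕ m * y + z))) A + y * Φ (suc r) (λ z → h (ιℕ m * y + z)) A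
  term y = trans (cong (y *_) (Φ-cons r _ x A)) (trans (*-distribˡ-+ y _ _)
    (cong (λ z → y * z + y * Φ (suc r) (λ z → h (ιℕ m * y + z)) A) (∑-cong (sSums r A) (λ z →
      cong h (solve 3 (λ u x z → u :+ (x :+ z) := x :+ (u :+ z)) refl (ιℕ m * y) x z)))))

pairSum-zero : ∀ m h A → pairSum m 0 h A A ≡ disjointSum m 0 h A
pairSum-zero m h []      = refl
pairSum-zero m h (x ∷ A) = cong (_+_ (x * Φ 0 (λ z → h (ιℕ m * x + z)) A)) (pairSum-zero m h A)

suc-multiple : ∀ m x z → ιℕ m * x + (x + z) ≡ ιℕ (suc m) * x + z
suc-multiple m x z = trans (solve 3 (λ m x z → m :* x :+ (x :+ z) := (con 1ℚ :+ m) :* x :+ z) refl (ιℕ m) x z)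
  (cong (λ c → c * x + z) (sym (ιℕ-suc m)))

-- A pair (i, S) with i in S corresponds to the disjoint pair of i and S without i. As m y + (y + z)
-- = (m + 1) y + z, the multiplier grows by one while the set loses one element.
pairSum-suc : ∀ m r h A → pairSum m (suc r) h A A ≡ disjointSum m (suc r) h A + disjointSum (suc m) r h A
pairSum-suc m r h []      = refl
pairSum-suc m r h (x ∷ A) = trans
  (cong₂ _+_
    (cong (x *_) (trans (Φ-cons r (λ z → h (ιℕ m * x + z)) x A)
      (cong (_+ Φ (suc r) (λ z → h (ιℕ m * x + z)) A) (∑-cong (sSums r A) (λ z → cong h (suc-multiple m x z))))))
    (trans (pairSum-cons m r h A x A) (cong (_+_ (pairSum m r (λ z → h (x + z)) A A)) (pairSum-suc m r h A))))
  (split r)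
  where
  a : ℕ → ℚ
  a r = Φ r (λ z → h (ιℕ (suc m) * x + z)) A
  b : ℕ → ℚ
  b r = Φ (suc r) (λ z → h (ιℕ m * x + z)) A
  -- A set of r = 0 positions cannot contain the position of x, so `disjointSum` lacks a summand
  -- there and r = 0 is treated apart.
  split : ∀ r → x * (a r + b r) + (pairSum m r (λ z → h (x + z)) A A + (disjointSum m (suc r) h A + disjointSum (suc m) r h A))
    ≡ disjointSum m (suc r) h (x ∷ A) + disjointSum (suc m) r h (x ∷ A)
  split zero    = trans (cong (λ p → x * (a 0 + b 0) + (p + (disjointSum m 1 h A + disjointSum (suc m) 0 h A)))
                          (pairSum-zero m (λ z → h (x + z)) A))
    (solve 6 (λ x a b p q u → x :* (a :+ b) :+ (p :+ (q :+ u)) := x :* b :+ (p :+ q) :+ (x :* a :+ u)) refl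
      x (a 0) (b 0) (disjointSum m 0 (λ z → h (x + z)) A) (disjointSum m 1 h A) (disjointSum (suc m) 0 h A))
  split (suc r) = trans (cong (λ p → x * (a (suc r) + b (suc r))
      + (p + (disjointSum m (suc (suc r)) h A + disjointSum (suc m) (suc r) h A)))
      (pairSum-suc m r (λ z → h (x + z)) A))
    (solve 7 (λ x a b p v q u → x :* (a :+ b) :+ (p :+ v :+ (q :+ u)) := x :* b :+ (p :+ q) :+ (x :* a :+ (v :+ u))) refl
      x (a (suc r)) (b (suc r)) (disjointSum m (suc r) (λ z → h (x + z)) A) (disjointSum (suc m) r (λ z → h (x + z)) A)
      (disjointSum m (suc (suc r)) h A) (disjointSum (suc m) (suc r) h A))

-- The factor y is the sum of the r + 1 chosen elements; distributing it singles out one of them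
-- beside r others.
Φ-times : ∀ r h A → Φ (suc r) (λ y → y * h y) A ≡ disjointSum 1 r h A
Φ-times r       h []      = refl
Φ-times r h (x ∷ A) = begin
  Φ (suc r) (λ y → y * h y) (x ∷ A)
    ≡⟨ Φ-cons r (λ y → y * h y) x A ⟩
  Φ r (λ z → (x + z) * h (x + z)) A + Φ (suc r) (λ y → y * h y) A
    ≡⟨ cong₂ _+_ (trans (∑-cong (sSums r A) (λ z → *-distribʳ-+ (h (x + z)) x z))
         (trans (∑-+ (sSums r A) _ _) (cong (_+ Φ r (λ z → z * h (x + z)) A) (∑-scale (sSums r A) x _))))
         (Φ-times r h A) ⟩
  x * Φ r (λ z → h (x + z)) A + Φ r (λ z → z * h (x + z)) A + disjointSum 1 r h A
    ≡⟨ cong (λ u → x * u + Φ r (λ z → z * h (x + z)) A + disjointSum 1 r h A)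
         (∑-cong (sSums r A) (λ z → cong (λ u → h (u + z)) (sym (*-identityˡ x)))) ⟩
  x * Φ r (λ z → h (ιℕ 1 * x + z)) A + Φ r (λ z → z * h (x + z)) A + disjointSum 1 r h A
    ≡⟨ split r ⟩
  disjointSum 1 r h (x ∷ A) ∎
  where
  split : ∀ r → x * Φ r (λ z → h (ιℕ 1 * x + z)) A + Φ r (λ z → z * h (x + z)) A + disjointSum 1 r h A
    ≡ disjointSum 1 r h (x ∷ A)
  split zero    = solve 3 (λ p q u → p :+ (con 0ℚ :* q :+ con 0ℚ) :+ u := p :+ u) refl
    (x * Φ 0 (λ z → h (ιℕ 1 * x + z)) A) (h (x + 0ℚ)) (disjointSum 1 0 h A)
  split (suc r) = trans (cong (λ u → x * Φ (suc r) (λ z → h (ιℕ 1 * x + z)) A + u + disjointSum 1 (suc r) h A)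
      (Φ-times r (λ z → h (x + z)) A))
    (+-assoc (x * Φ (suc r) (λ z → h (ιℕ 1 * x + z)) A) (disjointSum 1 r (λ z → h (x + z)) A) (disjointSum 1 (suc r) h A))

-- k! sumsPow s k A is the k-th power sum of A^{(s)}.
sumsPow : ℕ → ℕ → List ℚ → ℚ
sumsPow s k = Φ s (λ z → divPow z k)

-- Without disjointness the two choices are independent, and the addition theorem separates e^(myu)
-- from e^(zu). The extra factor y turns y^j into a contribution to the power sum of index j + 1.
pairSum-divPow : ∀ m r k A → pairSum m r (λ z → divPow z k) A A ≡
  Σ< (suc k) (λ j → powQ (ιℕ m) j * inv (j !) * (powerSums A j * sumsPow r (k ∸ j) A))
pairSum-divPow m r k A = begin
  ∑ A (λ y → y * ∑ (sSums r A) (λ z → divPow (ιℕ m * y + z) k))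
    ≡⟨ ∑-cong A (λ y → cong (y *_) (∑-cong (sSums r A) (λ z →
         trans (divPow-+ (ιℕ m * y) z k) (conv-as-Σ< (divPow (ιℕ m * y)) (divPow z) k)))) ⟩
  ∑ A (λ y → y * ∑ (sSums r A) (λ z → Σ< (suc k) (λ j → divPow (ιℕ m * y) j * divPow z (k ∸ j))))
    ≡⟨ ∑-cong A (λ y → trans (cong (y *_) (trans (∑-Σ< (sSums r A) (suc k) (λ z j → divPow (ιℕ m * y) j * divPow z (k ∸ j)))
         (Σ<-cong (suc k) (λ j → ∑-scale (sSums r A) (divPow (ιℕ m * y) j) (λ z → divPow z (k ∸ j))))))
         (*-Σ< (suc k) y (λ j → divPow (ιℕ m * y) j * sumsPow r (k ∸ j) A))) ⟩
  ∑ A (λ y → Σ< (suc k) (λ j → y * (divPow (ιℕ m * y) j * sumsPow r (k ∸ j) A)))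
    ≡⟨ ∑-Σ< A (suc k) (λ y j → y * (divPow (ιℕ m * y) j * sumsPow r (k ∸ j) A)) ⟩
  Σ< (suc k) (λ j → ∑ A (λ y → y * (divPow (ιℕ m * y) j * sumsPow r (k ∸ j) A)))
    ≡⟨ Σ<-cong (suc k) term ⟩
  Σ< (suc k) (λ j → powQ (ιℕ m) j * inv (j !) * (powerSums A j * sumsPow r (k ∸ j) A)) ∎
  where
  term : ∀ j → _
  term j = begin
    ∑ A (λ y → y * (divPow (ιℕ m * y) j * F))
      ≡⟨ ∑-cong A (λ y → trans
           (cong (λ d → y * (d * F)) (trans (divPow-scale (ιℕ m) y j) (cong (powQ (ιℕ m) j *_) (divPow-powQ y j))))
           (solve 5 (λ y p i q f → y :* (p :* (i :* q) :* f) := p :* i :* f :* (y :* q)) refl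
             y (powQ (ιℕ m) j) (inv (j !)) (powQ y j) F)) ⟩
    ∑ A (λ y → powQ (ιℕ m) j * inv (j !) * F * powQ y (suc j))
      ≡⟨ ∑-scale A (powQ (ιℕ m) j * inv (j !) * F) _ ⟩
    powQ (ιℕ m) j * inv (j !) * F * powerSums A j
      ≡⟨ solve 3 (λ c f p → c :* f :* p := c :* (p :* f)) refl (powQ (ιℕ m) j * inv (j !)) F (powerSums A j) ⟩
    powQ (ιℕ m) j * inv (j !) * (powerSums A j * F) ∎
    where F = sumsPow r (k ∸ j) A

sumsPow-suc : ∀ r k A → ιℕ (suc k) * sumsPow (suc r) (suc k) A ≡ disjointSum 1 r (λ z → divPow z k) A
sumsPow-suc r k A = begin
  ιℕ (suc k) * sumsPow (suc r) (suc k) A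
    ≡⟨ ∑-scale (sSums (suc r) A) (ιℕ (suc k)) (λ z → divPow z (suc k)) ⟨
  Φ (suc r) (λ z → ιℕ (suc k) * divPow z (suc k)) A
    ≡⟨ ∑-cong (sSums (suc r) A) (λ z → divPow-suc z k) ⟩
  Φ (suc r) (λ z → z * divPow z k) A
    ≡⟨ Φ-times r (λ z → divPow z k) A ⟩
  disjointSum 1 r (λ z → divPow z k) A ∎

sumsPow-zeroˡ : ∀ k A → sumsPow 0 (suc k) A ≡ 0ℚ
sumsPow-zeroˡ k A = solve 2 (λ i d → i :* (con 0ℚ :* d) :+ con 0ℚ := con 0ℚ) refl (inv (suc k)) (divPow 0ℚ k)

sumsPow-zeroʳ : ∀ s A → sumsPow s 0 A ≡ ιℕ (length A C s)
sumsPow-zeroʳ zero    A       = refl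
sumsPow-zeroʳ (suc s) []      = refl
sumsPow-zeroʳ (suc s) (x ∷ A) = trans (Φ-cons s (λ _ → 1ℚ) x A)
  (trans (cong₂ _+_ (sumsPow-zeroʳ s A) (sumsPow-zeroʳ (suc s) A))
    (trans (sym (ιℕ-+ (length A C s) (length A C suc s))) (cong ιℕ (nCk+nC[k+1]≡[n+1]C[k+1] (length A) s))))
-- Expressing power sums of s-fold sums through power sums

inc : ∀ {K} → Vec ℕ K → ℕ → Vec ℕ K
inc []       i       = []
inc (e ∷ es) zero    = suc e ∷ es
inc (e ∷ es) (suc i) = e ∷ inc es i

at-inc : ∀ {K} (e : Vec ℕ K) {i} → i < K → at (inc e i) i ≡ suc (at e i)
at-inc (e ∷ es) {zero}  _       = refl
at-inc (e ∷ es) {suc i} (s≤s p) = at-inc es p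

dec-inc : ∀ {K} (e : Vec ℕ K) i → dec (inc e i) i ≡ e
dec-inc []       i       = refl
dec-inc (e ∷ es) zero    = refl
dec-inc (e ∷ es) (suc i) = cong (e ∷_) (dec-inc es i)

inc-dec : ∀ {K} (e : Vec ℕ K) i {m} → at e i ≡ suc m → inc (dec e i) i ≡ e
inc-dec (suc e ∷ es) zero    p = refl
inc-dec (e ∷ es)     (suc i) p = cong (e ∷_) (inc-dec es i p)

evalMono-inc : ∀ {K} (e : Vec ℕ K) t {j} → j < K → evalMono (inc e j) (t ∘ toℕ) ≡ t j * evalMono e (t ∘ toℕ)
evalMono-inc (e ∷ es) t {zero}  _       = *-assoc (t 0) (powQ (t 0) e) (evalMono es (t ∘ suc ∘ toℕ))
evalMono-inc (e ∷ es) t {suc j} (s≤s p) = trans (cong (powQ (t 0) e *_) (evalMono-inc es (t ∘ suc) p))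
  (solve 3 (λ x y z → x :* (y :* z) := y :* (x :* z)) refl (powQ (t 0) e) (t (suc j)) (evalMono es (t ∘ suc ∘ toℕ)))

mulVar : ∀ {K} → ℕ → Poly K → Poly K
mulVar j = map (λ (c , e) → c , inc e j)

evalPoly-mulVar : ∀ {K} (P : Poly K) t {j} → j < K → evalPoly (mulVar j P) (t ∘ toℕ) ≡ t j * evalPoly P (t ∘ toℕ)
evalPoly-mulVar []            t {j} p = sym (*-zeroʳ (t j))
evalPoly-mulVar ((c , e) ∷ P) t {j} p = trans
  (cong₂ (λ x y → c * x + y) (evalMono-inc e t p) (evalPoly-mulVar P t p))
  (solve 4 (λ c t x y → c :* (t :* x) :+ t :* y := t :* (c :* x :+ y)) refl
    c (t j) (evalMono e (t ∘ toℕ)) (evalPoly P (t ∘ toℕ)))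

coeff-mulVar-suc : ∀ {K} (P : Poly K) e j {m} → at e j ≡ suc m → coeff (mulVar j P) e ≡ coeff P (dec e j)
coeff-mulVar-suc []             e j p = refl
coeff-mulVar-suc ((c , e′) ∷ P) e j p with Vec.≡-dec ℕ._≟_ (inc e′ j) e | Vec.≡-dec ℕ._≟_ e′ (dec e j)
... | yes _  | yes _  = cong (c +_) (coeff-mulVar-suc P e j p)
... | no  _  | no  _  = coeff-mulVar-suc P e j p
... | yes i≡ | no  d≢ = contradiction (trans (sym (dec-inc e′ j)) (cong (λ e → dec e j) i≡)) d≢
... | no  i≢ | yes d≡ = contradiction (trans (cong (λ e → inc e j) d≡) (inc-dec e j p)) i≢

coeff-mulVar-zero : ∀ {K} (P : Poly K) e {j} → j < K → at e j ≡ 0 → coeff (mulVar j P) e ≡ 0ℚ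
coeff-mulVar-zero []             e     j<K p = refl
coeff-mulVar-zero ((c , e′) ∷ P) e {j} j<K p with Vec.≡-dec ℕ._≟_ (inc e′ j) e
... | yes refl = contradiction (trans (sym p) (at-inc e′ j<K)) (λ ())
... | no  _    = coeff-mulVar-zero P e j<K p

-- Values are taken on n elements because the coefficients depend on n. Coefficients are prescribed
-- in weight w only: the closed formula need not vanish in other weights, whereas the polynomials
-- built here are homogeneous.
record Represented {K} (n w : ℕ) (f : List ℚ → ℚ) (c : Vec ℕ K → ℚ) : Set where
  constructor represented
  field
    poly   : Poly K
    values : ∀ A → length A ≡ n → evalPoly poly (powerSums A ∘ toℕ) ≡ f A
    coeffs : ∀ e → weight e ≡ w → coeff poly e ≡ c e

open Represented

module _ {K n : ℕ} where

  represented-cong : ∀ {w f f′} {c c′ : Vec ℕ K → ℚ} → (∀ A → length A ≡ n → f A ≡ f′ A) →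
    (∀ e → weight e ≡ w → c e ≡ c′ e) → Represented n w f c → Represented n w f′ c′
  represented-cong p q r =
    represented (poly r) (λ A l → trans (values r A l) (p A l)) (λ e w → trans (coeffs r e w) (q e w))

  represented-0 : ∀ {w} → Represented {K} n w (λ _ → 0ℚ) (λ _ → 0ℚ)
  represented-0 = represented [] (λ _ _ → refl) (λ _ _ → refl)

  represented-scale : ∀ {w f} {c : Vec ℕ K → ℚ} y →
    Represented n w f c → Represented n w (λ A → y * f A) (λ e → y * c e)
  represented-scale y r = represented (scalePoly y (poly r))
    (λ A l → trans (evalPoly-scale y (poly r) _) (cong (y *_) (values r A l)))
    (λ e w → trans (coeff-scale y (poly r) e) (cong (y *_) (coeffs r e w)))

  represented-+ : ∀ {w f g} {c d : Vec ℕ K → ℚ} →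
    Represented n w f c → Represented n w g d → Represented n w (λ A → f A + g A) (λ e → c e + d e)
  represented-+ r s = represented (poly r ++ poly s)
    (λ A l → trans (evalPoly-++ (poly r) (poly s) _) (cong₂ _+_ (values r A l) (values s A l)))
    (λ e w → trans (coeff-++ (poly r) (poly s) e) (cong₂ _+_ (coeffs r e w) (coeffs s e w)))

  represented-Σ< : ∀ {w} N (F : ℕ → List ℚ → ℚ) (c : ℕ → Vec ℕ K → ℚ) →
    (∀ i → i < N → Represented n w (F i) (c i)) →
    Represented n w (λ A → Σ< N (λ i → F i A)) (λ e → Σ< N (λ i → c i e))
  represented-Σ< zero    F c r = represented-0
  represented-Σ< (suc N) F c r =
    represented-+ (r 0 (s≤s z≤n)) (represented-Σ< N (F ∘ suc) (c ∘ suc) (λ i i<N → r (suc i) (s≤s i<N)))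

  represented-var : ∀ {w f j} {c c′ : Vec ℕ K → ℚ} → j < K →
    (∀ e {m} → at e j ≡ suc m → c (dec e j) ≡ c′ e) → (∀ e → at e j ≡ 0 → 0ℚ ≡ c′ e) →
    Represented n w f c → Represented n (suc j ℕ.+ w) (λ A → powerSums A j * f A) c′
  represented-var {w} {f} {j} {c} {c′} j<K p q r = represented (mulVar j (poly r))
    (λ A l → trans (evalPoly-mulVar (poly r) (powerSums A) j<K) (cong (powerSums A j *_) (values r A l)))
    coeffs′
    where
    coeffs′ : ∀ e → weight e ≡ suc j ℕ.+ w → coeff (mulVar j (poly r)) e ≡ c′ e
    coeffs′ e eq with at e j in at≡
    ... | zero  = trans (coeff-mulVar-zero (poly r) e j<K at≡) (q e at≡)
    ... | suc m = trans (coeff-mulVar-suc (poly r) e j at≡) (trans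
      (coeffs r (dec e j) (ℕ.+-cancelˡ-≡ (suc j) _ _ (trans (sym (weight-dec e j at≡)) eq))) (p e at≡))

-- (-1)^i (m + i)^j
alternating : ℕ → ℕ → Seq
alternating m j zero    = powQ (ιℕ m) j
alternating m j (suc i) = - alternating (suc m) j i

-- Coefficients of Σ_{m ≥ 1} (-1)^(m - 1) m^j z^m, the factor that t_(j + 1) contributes to the coefficient formula.
partSeries : ℕ → Seq
partSeries j zero    = 0ℚ
partSeries j (suc m) = alternating 1 j m

conv-partSeries-suc : ∀ j b r → conv (partSeries j) b (suc r) ≡ conv (alternating 1 j) b r
conv-partSeries-suc j b r = trans (cong (_+ conv (alternating 1 j) b r) (*-zeroˡ (b (suc r))))
  (+-identityˡ (conv (alternating 1 j) b r))

binomials : ℕ → Seq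
binomials n s = ιℕ (n C s)

-- Up to division by `denom e`, the series in z that accompanies the monomial with exponents e when
-- the exponential of the generating function is expanded.
mainFactor : ∀ {K} → ℕ → Vec ℕ K → Seq
mainFactor n = convProd partSeries (binomials n)

-- The j! come from u^j/j!, the factorials of exponents from the exponential series. The offset o
-- counts the variables already passed.
denomFrom : ∀ {K} → ℕ → Vec ℕ K → ℕ
denomFrom o []       = 1
denomFrom o (e ∷ es) = (suc o !) ℕ.^ e ℕ.* e ! ℕ.* denomFrom (suc o) es

denomFrom≢0 : ∀ {K} o (e : Vec ℕ K) → ℕ.NonZero (denomFrom o e)
denomFrom≢0 o []       = _
denomFrom≢0 o (e ∷ es) = ℕ.m*n≢0 _ _ {{ℕ.m*n≢0 _ _ {{ℕ.m^n≢0 (suc o !) e {{suc o ℕ.!≢0}}}} {{e ℕ.!≢0}}}} {{denomFrom≢0 (suc o) es}}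

denom : ∀ {K} → Vec ℕ K → ℕ
denom = denomFrom 0

denom≢0 : ∀ {K} (e : Vec ℕ K) → ℕ.NonZero (denom e)
denom≢0 = denomFrom≢0 0

denomFrom-dec : ∀ {K} o (e : Vec ℕ K) i {m} → at e i ≡ suc m →
  denomFrom o e ≡ suc (o ℕ.+ i) ! ℕ.* at e i ℕ.* denomFrom o (dec e i)
denomFrom-dec o (suc e ∷ es) zero    eq = trans
  (cong (ℕ._* denomFrom (suc o) es) (begin
    a ℕ.* a ℕ.^ e ℕ.* (suc e ℕ.* e !)   ≡⟨ ℕ.[m*n]*[o*p]≡[m*o]*[n*p] a (a ℕ.^ e) (suc e) (e !) ⟩
    a ℕ.* suc e ℕ.* (a ℕ.^ e ℕ.* e !)   ∎))
  (trans (ℕ.*-assoc (a ℕ.* suc e) (a ℕ.^ e ℕ.* e !) (denomFrom (suc o) es))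
    (cong (λ z → suc z ! ℕ.* suc e ℕ.* (a ℕ.^ e ℕ.* e ! ℕ.* denomFrom (suc o) es)) (sym (ℕ.+-identityʳ o))))
  where a = suc o !
denomFrom-dec o (e ∷ es)     (suc i) eq = begin
  a ℕ.* denomFrom (suc o) es
    ≡⟨ cong (a ℕ.*_) (denomFrom-dec (suc o) es i eq) ⟩
  a ℕ.* (suc (suc o ℕ.+ i) ! ℕ.* at es i ℕ.* d)
    ≡⟨ ℕ.*-assoc a _ d ⟨
  a ℕ.* (suc (suc o ℕ.+ i) ! ℕ.* at es i) ℕ.* d
    ≡⟨ cong (ℕ._* d) (ℕ.*-comm a _) ⟩
  suc (suc o ℕ.+ i) ! ℕ.* at es i ℕ.* a ℕ.* d
    ≡⟨ ℕ.*-assoc (suc (suc o ℕ.+ i) ! ℕ.* at es i) a d ⟩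
  suc (suc o ℕ.+ i) ! ℕ.* at es i ℕ.* (a ℕ.* d)
    ≡⟨ cong (λ z → suc z ! ℕ.* at es i ℕ.* (a ℕ.* d)) (sym (ℕ.+-suc o i)) ⟩
  suc (o ℕ.+ suc i) ! ℕ.* at es i ℕ.* (a ℕ.* d) ∎
  where
  a = (suc o !) ℕ.^ e ℕ.* e !
  d = denomFrom (suc o) (dec es i)

-- The last factor t_(j+1) contributes (j+1)! e_j to `denom e`, where e_j is the exponent of
-- t_(j+1). The recursion supplies only j! of this, which leaves (j+1) e_j in the numerator.
inv-denom-dec : ∀ {K} (e : Vec ℕ K) j {m} → at e j ≡ suc m →
  inv (j !) * inv (denom (dec e j)) ≡ ιℕ (suc j) * ιℕ (at e j) * inv (denom e)
inv-denom-dec e j p = ιℕ-cancel D {{denom≢0 (dec e j)}} (begin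
  inv (j !) * inv D * ιℕ D
    ≡⟨ trans (*-assoc (inv (j !)) (inv D) (ιℕ D)) (trans (cong (inv (j !) *_) (inv-inverse D {{denom≢0 (dec e j)}})) (*-identityʳ (inv (j !)))) ⟩
  inv (j !)
    ≡⟨ *-identityʳ (inv (j !)) ⟨
  inv (j !) * 1ℚ
    ≡⟨ cong (inv (j !) *_) (inv-inverse (denom e) {{denom≢0 e}}) ⟨
  inv (j !) * (inv (denom e) * ιℕ (denom e))
    ≡⟨ cong (λ z → inv (j !) * (inv (denom e) * z)) (trans (cong ιℕ (denomFrom-dec 0 e j p)) (trans (ιℕ-* (suc j ! ℕ.* at e j) D)
         (cong (_* ιℕ D) (trans (ιℕ-* (suc j !) (at e j)) (cong (_* ιℕ (at e j)) (ιℕ-* (suc j) (j !))))))) ⟩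
  inv (j !) * (inv (denom e) * (ιℕ (suc j) * ιℕ (j !) * ιℕ (at e j) * ιℕ D))
    ≡⟨ solve 6 (λ f i s g a d → f :* (i :* (s :* g :* a :* d)) := f :* (g :* (s :* a :* i :* d))) refl
         (inv (j !)) (inv (denom e)) (ιℕ (suc j)) (ιℕ (j !)) (ιℕ (at e j)) (ιℕ D) ⟩
  inv (j !) * (ιℕ (j !) * (ιℕ (suc j) * ιℕ (at e j) * inv (denom e) * ιℕ D))
    ≡⟨ inv-ιℕ-cancel (j !) {{j ℕ.!≢0}} _ ⟩
  ιℕ (suc j) * ιℕ (at e j) * inv (denom e) * ιℕ D ∎)
  where D = denom (dec e j)

-- A nonzero entry of index N or more would alone weigh more than o + N, so cutting the sum at N
-- loses nothing. The cut-off matches the range of j in the recursion.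
weightFrom-Σ< : ∀ {K} o (e : Vec ℕ K) N → weightFrom o e ≤ o ℕ.+ N →
  Σ< N (λ j → ιℕ (suc (o ℕ.+ j)) * ιℕ (at e j)) ≡ ιℕ (weightFrom o e)
weightFrom-Σ< o []       N l = Σ<-zero N _ (λ j → *-zeroʳ (ιℕ (suc (o ℕ.+ j))))
weightFrom-Σ< o (zero ∷ es) zero    l = weightFrom-Σ< (suc o) es zero (ℕ.≤-trans l (ℕ.n≤1+n (o ℕ.+ 0)))
weightFrom-Σ< o (suc e ∷ es) zero    l = contradiction
  (ℕ.≤-trans (s≤s (ℕ.≤-trans (ℕ.m≤m+n o (e ℕ.* suc o)) (ℕ.m≤m+n (o ℕ.+ e ℕ.* suc o) (weightFrom (suc o) es))))
    (ℕ.≤-trans l (ℕ.≤-reflexive (ℕ.+-identityʳ o)))) ℕ.1+n≰n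
weightFrom-Σ< o (e ∷ es) (suc N) l = trans
  (cong₂ _+_
    (trans (cong (λ z → ιℕ (suc z) * ιℕ e) (ℕ.+-identityʳ o)) (trans (*-comm (ιℕ (suc o)) (ιℕ e)) (sym (ιℕ-* e (suc o)))))
    (trans (Σ<-cong N (λ j → cong (λ z → ιℕ (suc z) * ιℕ (at es j)) (ℕ.+-suc o j)))
      (weightFrom-Σ< (suc o) es N (ℕ.≤-trans (ℕ.m≤n+m (weightFrom (suc o) es) (e ℕ.* suc o))
        (ℕ.≤-trans l (ℕ.≤-reflexive (ℕ.+-suc o N)))))))
  (sym (ιℕ-+ (e ℕ.* suc o) (weightFrom (suc o) es)))

weight-zeros : ∀ {K} o → weightFrom o (zeros {K}) ≡ 0
weight-zeros {zero}  o = refl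
weight-zeros {suc K} o = weight-zeros {K} (suc o)

weight-0⇒zeros : ∀ {K} (e : Vec ℕ K) → weight e ≡ 0 → e ≡ zeros
weight-0⇒zeros e w≡0 with zeros-or-positive e
... | inj₁ eq              = eq
... | inj₂ (i , m , _ , p) = contradiction (trans (sym w≡0) (weight-dec e i p)) (λ ())

convProd-zeros : ∀ {K} g b → convProd g b (zeros {K}) ≡ b
convProd-zeros {zero}  g b = refl
convProd-zeros {suc K} g b = convProd-zeros {K} (g ∘ suc) b

denom-zeros : ∀ {K} o → denomFrom o (zeros {K}) ≡ 1
denom-zeros {zero}  o = refl
denom-zeros {suc K} o = trans (ℕ.+-identityʳ (denomFrom (suc o) (zeros {K}))) (denom-zeros {K} (suc o))

closedCoeff : ∀ {K} → ℕ → ℕ → Vec ℕ K → ℚ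
closedCoeff n s e = mainFactor n e s * inv (denom e)

-- The scalar found in `inv-denom-dec`, with which the recursion term of t_(j+1) reaches the
-- monomial e.
stepWeight : ∀ {K} → Vec ℕ K → ℕ → ℚ
stepWeight e j = ιℕ (suc j) * ιℕ (at e j) * inv (denom e)

stepWeight-zero : ∀ {K} (e : Vec ℕ K) j → at e j ≡ 0 → stepWeight e j ≡ 0ℚ
stepWeight-zero e j p = trans (cong (λ a → ιℕ (suc j) * ιℕ a * inv (denom e)) p)
  (trans (cong (_* inv (denom e)) (*-zeroʳ (ιℕ (suc j)))) (*-zeroˡ (inv (denom e))))

-- Existence: the closed form satisfies the recursion

module Existence (K n : ℕ) where

  PairCoeff : ℕ → ℕ → ℕ → Vec ℕ K → ℚ
  PairCoeff m r k e = Σ< (suc k) (λ j → powQ (ιℕ m) j * (stepWeight e j * mainFactor n (dec e j) r))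

  represented-pairSum : ∀ m r k → k < K →
    (∀ k′ → k′ ≤ k → Represented {K} n k′ (sumsPow r k′) (closedCoeff n r)) →
    Represented {K} n (suc k) (λ A → pairSum m r (λ z → divPow z k) A A) (PairCoeff m r k)
  represented-pairSum m r k k<K rep = represented-cong (λ A _ → sym (pairSum-divPow m r k A))
    (λ e _ → refl)
    (represented-Σ< (suc k) value coefficient summand)
    where
    value : ℕ → List ℚ → ℚ
    value j A = powQ (ιℕ m) j * inv (j !) * (powerSums A j * sumsPow r (k ∸ j) A)
    coefficient : ℕ → Vec ℕ K → ℚ
    coefficient j e = powQ (ιℕ m) j * (stepWeight e j * mainFactor n (dec e j) r)
    summand : ∀ j → j < suc k → Represented n (suc k) (value j) (coefficient j)
    summand j (s≤s j≤k) = represented-cong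
      (λ A _ → trans (cong (powQ (ιℕ m) j *_)
          (solve 3 (λ p i f → p :* (i :* f) := i :* (p :* f)) refl (powerSums A j) (inv (j !)) (sumsPow r (k ∸ j) A)))
        (sym (*-assoc (powQ (ιℕ m) j) (inv (j !)) (powerSums A j * sumsPow r (k ∸ j) A))))
      (λ e _ → refl)
      -- The new variable has weight j + 1 and the remaining factor weight k - j, together k + 1.
      (represented-scale (powQ (ιℕ m) j) (subst (λ w → Represented {K} n w
          (λ A → powerSums A j * (inv (j !) * sumsPow r (k ∸ j) A)) (λ e → stepWeight e j * mainFactor n (dec e j) r)) (cong suc (ℕ.m+[n∸m]≡n j≤k))
        (represented-var (ℕ.≤-<-trans j≤k k<K) coeff-suc coeff-zero
          (represented-scale (inv (j !)) (rep (k ∸ j) (ℕ.m∸n≤m k j))))))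
      where
      coeff-suc : ∀ e {m} → at e j ≡ suc m →
        inv (j !) * closedCoeff n r (dec e j) ≡ stepWeight e j * mainFactor n (dec e j) r
      coeff-suc e p = trans
        (solve 3 (λ i x d → i :* (x :* d) := i :* d :* x) refl (inv (j !)) (mainFactor n (dec e j) r) (inv (denom (dec e j))))
        (cong (_* mainFactor n (dec e j) r) (inv-denom-dec e j p))
      coeff-zero : ∀ e → at e j ≡ 0 → 0ℚ ≡ stepWeight e j * mainFactor n (dec e j) r
      coeff-zero e p = sym (trans (cong (_* mainFactor n (dec e j) r) (stepWeight-zero e j p))
        (*-zeroˡ (mainFactor n (dec e j) r)))

  -- Unrolling `pairSum-suc` gives an alternating sum over the multipliers m, m + 1, ..., which is
  -- convolution with Σ_i (-1)^i (m + i)^j z^i.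
  DisjointCoeff : ℕ → ℕ → ℕ → Vec ℕ K → ℚ
  DisjointCoeff m r k e = Σ< (suc k) (λ j → stepWeight e j * conv (alternating m j) (mainFactor n (dec e j)) r)

  -- Induction on r through `pairSum-suc`, solved for its first disjoint sum. The multiplier m
  -- varies because the subtracted sum has m + 1.
  represented-disjointSum : ∀ r m k → k < K →
    (∀ r k′ → k′ ≤ k → Represented {K} n k′ (sumsPow r k′) (closedCoeff n r)) →
    Represented {K} n (suc k) (disjointSum m r (λ z → divPow z k)) (DisjointCoeff m r k)
  represented-disjointSum zero    m k k<K rep = represented-cong
    (λ A _ → pairSum-zero m (λ z → divPow z k) A)
    (λ e _ → Σ<-cong (suc k) (λ j → solve 3 (λ p w x → p :* (w :* x) := w :* (p :* x)) refl
      (powQ (ιℕ m) j) (stepWeight e j) (mainFactor n (dec e j) 0)))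
    (represented-pairSum m 0 k k<K (rep 0))
  represented-disjointSum (suc r) m k k<K rep = represented-cong
    (λ A _ → trans (cong (_+ - 1ℚ * disjointSum (suc m) r (λ z → divPow z k) A) (pairSum-suc m r (λ z → divPow z k) A))
      (solve 2 (λ x y → x :+ y :+ con (- 1ℚ) :* y := x) refl
        (disjointSum m (suc r) (λ z → divPow z k) A) (disjointSum (suc m) r (λ z → divPow z k) A)))
    (λ e _ → trans (cong (PairCoeff m (suc r) k e +_) (*-Σ< (suc k) (- 1ℚ) (below e)))
      (trans (sym (Σ<-+ (suc k) (above e) (λ j → - 1ℚ * below e j))) (Σ<-cong (suc k) (term e))))
    (represented-+ (represented-pairSum m (suc r) k k<K (rep (suc r)))
      (represented-scale (- 1ℚ) (represented-disjointSum r (suc m) k k<K rep)))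
    where
    above below : Vec ℕ K → ℕ → ℚ
    above e j = powQ (ιℕ m) j * (stepWeight e j * mainFactor n (dec e j) (suc r))
    below e j = stepWeight e j * conv (alternating (suc m) j) (mainFactor n (dec e j)) r
    conv-neg : ∀ a b → conv (λ i → - a i) b r ≡ - conv a b r
    conv-neg a b = trans (conv-cong {b = b} (λ i → solve 1 (λ x → ⊝ x := con (- 1ℚ) :* x) refl (a i)) (λ _ → refl) r)
      (trans (conv-scaleˡ (- 1ℚ) a b r) (solve 1 (λ x → con (- 1ℚ) :* x := ⊝ x) refl (conv a b r)))
    term : ∀ e j → above e j + - 1ℚ * below e j
      ≡ stepWeight e j * conv (alternating m j) (mainFactor n (dec e j)) (suc r)
    term e j = trans
      (solve 4 (λ p w x y → p :* (w :* x) :+ con (- 1ℚ) :* (w :* y) := w :* (p :* x :+ ⊝ y)) refl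
        (powQ (ιℕ m) j) (stepWeight e j) (mainFactor n (dec e j) (suc r))
        (conv (alternating (suc m) j) (mainFactor n (dec e j)) r))
      (cong (λ z → stepWeight e j * (powQ (ιℕ m) j * mainFactor n (dec e j) (suc r) + z))
        (sym (conv-neg (alternating (suc m) j) (mainFactor n (dec e j)))))

  -- Up to the shift by z, convolving with `alternating 1 j` restores the factor of t_(j+1) that
  -- `dec` removed, so every j yields the same series `mainFactor n e`. What remains is the sum of
  -- the (j+1) e_j, the weight of e.
  disjointCoeff-closed : ∀ r k e → weight e ≡ suc k → DisjointCoeff 1 r k e ≡ ιℕ (suc k) * closedCoeff n (suc r) e
  disjointCoeff-closed r k e w≡ = begin
    DisjointCoeff 1 r k e
      ≡⟨ Σ<-cong (suc k) collapse ⟩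
    Σ< (suc k) (λ j → closedCoeff n (suc r) e * (ιℕ (suc j) * ιℕ (at e j)))
      ≡⟨ *-Σ< (suc k) (closedCoeff n (suc r) e) (λ j → ιℕ (suc j) * ιℕ (at e j)) ⟨
    closedCoeff n (suc r) e * Σ< (suc k) (λ j → ιℕ (suc j) * ιℕ (at e j))
      ≡⟨ cong (closedCoeff n (suc r) e *_) (trans (weightFrom-Σ< 0 e (suc k) (ℕ.≤-reflexive w≡)) (cong ιℕ w≡)) ⟩
    closedCoeff n (suc r) e * ιℕ (suc k)
      ≡⟨ *-comm (closedCoeff n (suc r) e) (ιℕ (suc k)) ⟩
    ιℕ (suc k) * closedCoeff n (suc r) e ∎
    where
    collapse : ∀ j → stepWeight e j * conv (alternating 1 j) (mainFactor n (dec e j)) r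
      ≡ closedCoeff n (suc r) e * (ιℕ (suc j) * ιℕ (at e j))
    collapse j with at e j in at≡
    -- No factor was removed here, so the series is not restored to that of e; both sides are 0
    -- through the exponent.
    ... | zero  = trans (cong (_* conv (alternating 1 j) (mainFactor n (dec e j)) r) zero-weight)
      (trans (*-zeroˡ (conv (alternating 1 j) (mainFactor n (dec e j)) r)) (sym (trans (cong (closedCoeff n (suc r) e *_) (*-zeroʳ (ιℕ (suc j)))) (*-zeroʳ (closedCoeff n (suc r) e)))))
      where
      zero-weight : ιℕ (suc j) * ιℕ 0 * inv (denom e) ≡ 0ℚ
      zero-weight = trans (cong (_* inv (denom e)) (*-zeroʳ (ιℕ (suc j)))) (*-zeroˡ (inv (denom e)))
    ... | suc m = trans
      (cong (ιℕ (suc j) * ιℕ (suc m) * inv (denom e) *_)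
        (sym (trans (convProd-dec partSeries (binomials n) e j at≡ (suc r))
                    (conv-partSeries-suc j (mainFactor n (dec e j)) r))))
      (solve 4 (λ s a d x → s :* a :* d :* x := x :* d :* (s :* a)) refl
        (ιℕ (suc j)) (ιℕ (suc m)) (inv (denom e)) (mainFactor n e (suc r)))

  -- All s at once: the recursion strictly lowers k but refers to several set sizes.
  Claim : ℕ → Set
  Claim k = k ≤ K → ∀ s → Represented {K} n k (sumsPow s k) (closedCoeff n s)

  represented-sumsPow : ∀ k → Claim k
  represented-sumsPow = <-rec Claim step
    where
    step : ∀ k → (∀ {k′} → k′ < k → Claim k′) → Claim k
    -- The zeroth power sum counts the s-fold sums, so a constant polynomial represents it, and
    -- `zeros` is the only vector of weight 0.
    step zero    ih k≤K s = represented ((ιℕ (n C s) , zeros) ∷ [])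
      (λ A l → trans (trans (+-identityʳ _) (trans (cong (ιℕ (n C s) *_) (evalMono-zeros {K} _)) (*-identityʳ (ιℕ (n C s)))))
                     (trans (cong (λ l → ιℕ (l C s)) (sym l)) (sym (sumsPow-zeroʳ s A))))
      base-coeff
      where
      base-coeff : ∀ e → weight e ≡ 0 → coeff ((ιℕ (n C s) , zeros) ∷ []) e ≡ closedCoeff n s e
      base-coeff e w≡0 with weight-0⇒zeros e w≡0
      ... | refl = trans (coeff-zeros {K} ((ιℕ (n C s) , zeros) ∷ [])) (trans (+-identityʳ _)
        (cong₂ _*_ (cong (λ b → b s) (sym (convProd-zeros {K} partSeries (binomials n))))
          (trans (evalMono-zeros {K} (λ _ → 0ℚ)) (cong inv (sym (denom-zeros {K} 0))))))
    -- The only 0-fold sum is 0. In the formula, a vector of positive weight brings in some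
    -- `partSeries`, which has no constant term.
    step (suc k) ih k<K zero    = represented-cong (λ A _ → sym (sumsPow-zeroˡ k A)) vanish represented-0
      where
      vanish : ∀ e → weight e ≡ suc k → 0ℚ ≡ closedCoeff n 0 e
      vanish e w≡ with zeros-or-positive e
      ... | inj₁ refl            = contradiction (trans (sym w≡) (weight-zeros {K} 0)) (λ ())
      ... | inj₂ (j , m , _ , p) = sym (trans
        (cong (_* inv (denom e)) (trans (convProd-dec partSeries (binomials n) e j p 0) (*-zeroˡ (mainFactor n (dec e j) 0))))
        (*-zeroˡ (inv (denom e))))
    step (suc k) ih k<K (suc r) = represented-cong
      (λ A _ → trans (cong (inv (suc k) *_) (sym (sumsPow-suc r k A))) (inv-ιℕ-cancel (suc k) (sumsPow (suc r) (suc k) A)))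
      (λ e w≡ → trans (cong (inv (suc k) *_) (disjointCoeff-closed r k e w≡)) (inv-ιℕ-cancel (suc k) (closedCoeff n (suc r) e)))
      (represented-scale (inv (suc k)) (represented-disjointSum r 1 k k<K
        (λ r k′ k′≤k → ih (s≤s k′≤k) (ℕ.≤-trans k′≤k (ℕ.<⇒≤ k<K)) r)))
-- From exponent vectors to partitions

tabulate-inc : ∀ K (c c′ : ℕ → ℕ) i → c′ i ≡ suc (c i) → (∀ j → j ≢ i → c′ j ≡ c j) →
  Vec.tabulate {n = K} (c′ ∘ toℕ) ≡ inc (Vec.tabulate (c ∘ toℕ)) i
tabulate-inc zero    c c′ i       p q = refl
tabulate-inc (suc K) c c′ zero    p q = cong₂ _∷_ p (Vec.tabulate-cong (λ j → q (suc (toℕ j)) (λ ())))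
tabulate-inc (suc K) c c′ (suc i) p q = cong₂ _∷_ (q 0 (λ ()))
  (tabulate-inc K (c ∘ suc) (c′ ∘ suc) i p (λ j j≢i → q (suc j) (λ eq → j≢i (ℕ.suc-injective eq))))

count-same : ∀ v lam → count v (v ∷ lam) ≡ suc (count v lam)
count-same v lam = cong length (List.filter-accept (ℕ._≟ v) refl)

count-other : ∀ {v x} lam → x ≢ v → count v (x ∷ lam) ≡ count v lam
count-other {v} lam x≢v = cong length (List.filter-reject (ℕ._≟ v) x≢v)

monoOf-∷ : ∀ K i lam → monoOf K (suc i ∷ lam) ≡ inc (monoOf K lam) i
monoOf-∷ K i lam = tabulate-inc K (λ j → count (suc j) lam) (λ j → count (suc j) (suc i ∷ lam)) i
  (count-same (suc i) lam) (λ j j≢i → count-other lam (λ eq → j≢i (sym (ℕ.suc-injective eq))))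

monoOf-[] : ∀ K → monoOf K [] ≡ zeros
monoOf-[] zero    = refl
monoOf-[] (suc K) = cong (0 ∷_) (monoOf-[] K)

-- Every part v names one of the variables t_1, ..., t_K. Unlike summing to K, this passes to tails,
-- as inductions on the list require.
Parts : ℕ → List ℕ → Set
Parts K = All (λ v → Σ ℕ λ i → i < K × v ≡ suc i)

parts-bounded : ∀ {K} lam → All (1 ≤_) lam → sumℕ lam ≤ K → Parts K lam
parts-bounded []            []        l = []
parts-bounded (suc i ∷ lam) (p ∷ pos) l = (i , ℕ.≤-trans (ℕ.m≤m+n (suc i) (sumℕ lam)) l , refl)
  ∷ parts-bounded lam pos (ℕ.≤-trans (ℕ.m≤n+m (sumℕ lam) (suc i)) l)

weight-monoOf : ∀ {K} lam → Parts K lam → weight (monoOf K lam) ≡ sumℕ lam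
weight-monoOf {K} []  []                             = trans (cong weight (monoOf-[] K)) (weight-zeros {K} 0)
weight-monoOf {K} (_ ∷ lam) ((i , i<K , refl) ∷ ps) = begin
  weight (monoOf K (suc i ∷ lam))
    ≡⟨ cong weight (monoOf-∷ K i lam) ⟩
  weight (inc (monoOf K lam) i)
    ≡⟨ weight-dec (inc (monoOf K lam) i) i (at-inc (monoOf K lam) i<K) ⟩
  suc i ℕ.+ weight (dec (inc (monoOf K lam) i) i)
    ≡⟨ cong (λ e → suc i ℕ.+ weight e) (dec-inc (monoOf K lam) i) ⟩
  suc i ℕ.+ weight (monoOf K lam)
    ≡⟨ cong (suc i ℕ.+_) (weight-monoOf lam ps) ⟩
  suc i ℕ.+ sumℕ lam ∎

-- Factorials of multiplicities

Π< : ℕ → (ℕ → ℕ) → ℕ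
Π< zero    f = 1
Π< (suc N) f = f 0 ℕ.* Π< N (f ∘ suc)

Π<-cong : ∀ N {f g} → (∀ i → f i ≡ g i) → Π< N f ≡ Π< N g
Π<-cong zero    p = refl
Π<-cong (suc N) p = cong₂ ℕ._*_ (p 0) (Π<-cong N (p ∘ suc))

Π<-one : ∀ N f → (∀ i → f i ≡ 1) → Π< N f ≡ 1
Π<-one zero    f p = refl
Π<-one (suc N) f p = cong₂ ℕ._*_ (p 0) (Π<-one N (f ∘ suc) (p ∘ suc))

Π<-split : ∀ N f g {i} → i < N → g i ≡ 1 → (∀ j → j ≢ i → g j ≡ f j) → Π< N f ≡ f i ℕ.* Π< N g
Π<-split (suc N) f g {zero}  _       p q = cong (f 0 ℕ.*_) (trans
  (Π<-cong N (λ j → sym (q (suc j) (λ ())))) (trans (sym (ℕ.*-identityˡ _)) (cong (ℕ._* Π< N (g ∘ suc)) (sym p))))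
Π<-split (suc N) f g {suc i} (s≤s i<N) p q = begin
  f 0 ℕ.* Π< N (f ∘ suc)
    ≡⟨ cong (f 0 ℕ.*_) (Π<-split N (f ∘ suc) (g ∘ suc) i<N p (λ j j≢i → q (suc j) (λ eq → j≢i (ℕ.suc-injective eq)))) ⟩
  f 0 ℕ.* (f (suc i) ℕ.* Π< N (g ∘ suc))
    ≡⟨ ℕ.*-assoc (f 0) (f (suc i)) _ ⟨
  f 0 ℕ.* f (suc i) ℕ.* Π< N (g ∘ suc)
    ≡⟨ cong (ℕ._* Π< N (g ∘ suc)) (ℕ.*-comm (f 0) (f (suc i))) ⟩
  f (suc i) ℕ.* f 0 ℕ.* Π< N (g ∘ suc)
    ≡⟨ ℕ.*-assoc (f (suc i)) (f 0) _ ⟩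
  f (suc i) ℕ.* (f 0 ℕ.* Π< N (g ∘ suc))
    ≡⟨ cong (λ z → f (suc i) ℕ.* (z ℕ.* Π< N (g ∘ suc))) (q 0 (λ ())) ⟨
  f (suc i) ℕ.* Π< (suc N) g ∎

listProduct : (ℕ → ℕ) → List ℕ → ℕ
listProduct g []       = 1
listProduct g (x ∷ xs) = g x ℕ.* listProduct g xs

prod!-map : ∀ c xs → prod! (map c xs) ≡ listProduct (λ v → c v !) xs
prod!-map c []       = refl
prod!-map c (x ∷ xs) = cong (c x ! ℕ.*_) (prod!-map c xs)

-- `deduplicate` filters its head out of the deduplicated tail. Setting the factor at x to 1 has the
-- same effect on a product and leaves the list intact.
omit : ℕ → (ℕ → ℕ) → ℕ → ℕ
omit x g v with x ℕ.≟ v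
... | yes _ = 1
... | no  _ = g v

omit-same : ∀ x g → omit x g x ≡ 1
omit-same x g with x ℕ.≟ x
... | yes _   = refl
... | no  x≢x = contradiction refl x≢x

omit-other : ∀ {x v} g → v ≢ x → omit x g v ≡ g v
omit-other {x} {v} g v≢x with x ℕ.≟ v
... | yes x≡v = contradiction (sym x≡v) v≢x
... | no  _   = refl

listProduct-filter : ∀ x g ys → listProduct g (filter (¬? ∘ (x ℕ.≟_)) ys) ≡ listProduct (omit x g) ys
listProduct-filter x g []       = refl
listProduct-filter x g (y ∷ ys) with x ℕ.≟ y
... | yes x≡y = trans (cong (listProduct g) (List.filter-reject (¬? ∘ (x ℕ.≟_)) (λ x≢y → x≢y x≡y)))
                  (trans (listProduct-filter x g ys) (sym (ℕ.*-identityˡ _)))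
... | no  x≢y = trans (cong (listProduct g) (List.filter-accept (¬? ∘ (x ℕ.≟_)) x≢y))
                  (cong (g y ℕ.*_) (listProduct-filter x g ys))

-- Any g that is 1 off the list is allowed, so that the induction can pass to `omit x g`. For
-- factorials of multiplicities the condition is 0! = 1.
listProduct-deduplicate : ∀ {K} g lam → Parts K lam → (∀ v → v ∉ lam → g v ≡ 1) →
  listProduct g (deduplicate ℕ._≟_ lam) ≡ Π< K (g ∘ suc)
listProduct-deduplicate {K} g []        []                      p = sym (Π<-one K (g ∘ suc) (λ i → p (suc i) (λ ())))
listProduct-deduplicate {K} g (_ ∷ lam) ((i , i<K , refl) ∷ ps) p = begin
  g x ℕ.* listProduct g (filter (¬? ∘ (x ℕ.≟_)) (deduplicate ℕ._≟_ lam))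
    ≡⟨ cong (g x ℕ.*_) (listProduct-filter x g (deduplicate ℕ._≟_ lam)) ⟩
  g x ℕ.* listProduct (omit x g) (deduplicate ℕ._≟_ lam)
    ≡⟨ cong (g x ℕ.*_) (listProduct-deduplicate (omit x g) lam ps omitted) ⟩
  g x ℕ.* Π< K (omit x g ∘ suc)
    ≡⟨ Π<-split K (g ∘ suc) (omit x g ∘ suc) i<K (omit-same x g)
         (λ j j≢i → omit-other g (λ eq → j≢i (ℕ.suc-injective eq))) ⟨
  Π< K (g ∘ suc) ∎
  where
  x = suc i
  omitted : ∀ v → v ∉ lam → omit x g v ≡ 1
  omitted v v∉ with v ℕ.≟ x
  ... | yes refl = omit-same x g
  ... | no  v≢x  = trans (omit-other g v≢x) (p v λ { (here eq) → v≢x eq ; (there v∈) → v∉ v∈ })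

count-∉ : ∀ v lam → v ∉ lam → count v lam ≡ 0
count-∉ v []        v∉ = refl
count-∉ v (x ∷ lam) v∉ = trans (count-other lam (λ x≡v → v∉ (here (sym x≡v)))) (count-∉ v lam (v∉ ∘ there))

entryFactorials : ∀ {K} → Vec ℕ K → ℕ
entryFactorials e = prod! (toList e)

prod!-tabulate : ∀ K c → entryFactorials (Vec.tabulate {n = K} (c ∘ toℕ)) ≡ Π< K (λ j → c j !)
prod!-tabulate zero    c = refl
prod!-tabulate (suc K) c = cong (c 0 ! ℕ.*_) (prod!-tabulate K (c ∘ suc))

prod!-multiplicities : ∀ {K} lam → Parts K lam → prod! (multiplicities lam) ≡ entryFactorials (monoOf K lam)
prod!-multiplicities {K} lam ps = trans (prod!-map (λ v → count v lam) (deduplicate ℕ._≟_ lam))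
  (trans (listProduct-deduplicate (λ v → count v lam !) lam ps (λ v v∉ → cong _! (count-∉ v lam v∉)))
    (sym (prod!-tabulate K (λ j → count (suc j) lam))))

entryFactorials-inc : ∀ {K} (e : Vec ℕ K) {i} → i < K → entryFactorials (inc e i) ≡ suc (at e i) ℕ.* entryFactorials e
entryFactorials-inc (e ∷ es) {zero}  _       = ℕ.*-assoc (suc e) (e !) (entryFactorials es)
entryFactorials-inc (e ∷ es) {suc i} (s≤s p) = begin
  e ! ℕ.* entryFactorials (inc es i)                   ≡⟨ cong (e ! ℕ.*_) (entryFactorials-inc es p) ⟩
  e ! ℕ.* (suc (at es i) ℕ.* entryFactorials es)       ≡⟨ ℕ.*-assoc (e !) (suc (at es i)) _ ⟨
  e ! ℕ.* suc (at es i) ℕ.* entryFactorials es         ≡⟨ cong (ℕ._* entryFactorials es) (ℕ.*-comm (e !) (suc (at es i))) ⟩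
  suc (at es i) ℕ.* e ! ℕ.* entryFactorials es         ≡⟨ ℕ.*-assoc (suc (at es i)) (e !) _ ⟩
  suc (at es i) ℕ.* (e ! ℕ.* entryFactorials es)       ∎

entryFactorials-zeros : ∀ K → entryFactorials (zeros {K}) ≡ 1
entryFactorials-zeros zero    = refl
entryFactorials-zeros (suc K) = trans (ℕ.+-identityʳ _) (entryFactorials-zeros K)

-- Adding a part v multiplies both sides by v! and by the new multiplicity of v.
denom-monoOf-split : ∀ {K} lam → Parts K lam → denom (monoOf K lam) ≡ prod! lam ℕ.* entryFactorials (monoOf K lam)
denom-monoOf-split {K} [] [] = begin
  denom (monoOf K [])                  ≡⟨ cong denom (monoOf-[] K) ⟩
  denom (zeros {K})                    ≡⟨ denom-zeros {K} 0 ⟩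
  1                                    ≡⟨ entryFactorials-zeros K ⟨
  entryFactorials (zeros {K})          ≡⟨ cong entryFactorials (monoOf-[] K) ⟨
  entryFactorials (monoOf K [])        ≡⟨ ℕ.*-identityˡ _ ⟨
  1 ℕ.* entryFactorials (monoOf K [])  ∎
denom-monoOf-split {K} (_ ∷ lam) ((i , i<K , refl) ∷ ps) = begin
  denom (monoOf K (suc i ∷ lam))
    ≡⟨ cong denom (monoOf-∷ K i lam) ⟩
  denom (inc e i)
    ≡⟨ denomFrom-dec 0 (inc e i) i (at-inc e i<K) ⟩
  suc i ! ℕ.* at (inc e i) i ℕ.* denom (dec (inc e i) i)
    ≡⟨ cong₂ (λ a d → suc i ! ℕ.* a ℕ.* d) (at-inc e i<K)
         (trans (cong denom (dec-inc e i)) (denom-monoOf-split lam ps)) ⟩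
  suc i ! ℕ.* suc (at e i) ℕ.* (prod! lam ℕ.* entryFactorials e)
    ≡⟨ ℕ.[m*n]*[o*p]≡[m*o]*[n*p] (suc i !) (suc (at e i)) (prod! lam) (entryFactorials e) ⟩
  suc i ! ℕ.* prod! lam ℕ.* (suc (at e i) ℕ.* entryFactorials e)
    ≡⟨ cong (suc i ! ℕ.* prod! lam ℕ.*_)
         (trans (sym (entryFactorials-inc e i<K)) (cong entryFactorials (sym (monoOf-∷ K i lam)))) ⟩
  prod! (suc i ∷ lam) ℕ.* entryFactorials (monoOf K (suc i ∷ lam)) ∎
  where e = monoOf K lam

denom-monoOf : ∀ {K} lam → Parts K lam → denom (monoOf K lam) ≡ den lam
denom-monoOf lam ps = trans (denom-monoOf-split lam ps) (cong (prod! lam ℕ.*_) (sym (prod!-multiplicities lam ps)))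

-- `mainFactor` without (1 + z)^n, with one factor per part in the order of the list, which is the
-- order of the m_i in a composition.
compositionSeries : List ℕ → Seq
compositionSeries []        = δ 0
compositionSeries (v ∷ lam) = conv (partSeries (v ∸ 1)) (compositionSeries lam)

mainFactor-monoOf : ∀ {K} n lam → Parts K lam →
  mainFactor n (monoOf K lam) ≗ₛ conv (binomials n) (compositionSeries lam)
mainFactor-monoOf {K} n [] [] s = begin
  mainFactor n (monoOf K []) s   ≡⟨ cong (λ e → mainFactor n e s) (monoOf-[] K) ⟩
  mainFactor n (zeros {K}) s     ≡⟨ cong (λ b → b s) (convProd-zeros {K} partSeries (binomials n)) ⟩
  binomials n s                  ≡⟨ conv-δ0 (binomials n) s ⟨
  conv (δ 0) (binomials n) s     ≡⟨ conv-comm (δ 0) (binomials n) s ⟩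
  conv (binomials n) (δ 0) s     ∎
mainFactor-monoOf {K} n (_ ∷ lam) ((i , i<K , refl) ∷ ps) s = begin
  mainFactor n (monoOf K (suc i ∷ lam)) s
    ≡⟨ cong (λ e → mainFactor n e s) (monoOf-∷ K i lam) ⟩
  mainFactor n (inc e i) s
    ≡⟨ convProd-dec partSeries (binomials n) (inc e i) i (at-inc e i<K) s ⟩
  conv (partSeries i) (mainFactor n (dec (inc e i) i)) s
    ≡⟨ cong (λ e → conv (partSeries i) (mainFactor n e) s) (dec-inc e i) ⟩
  conv (partSeries i) (mainFactor n e) s
    ≡⟨ conv-cong {partSeries i} (λ _ → refl) (mainFactor-monoOf n lam ps) s ⟩
  conv (partSeries i) (conv (binomials n) (compositionSeries lam)) s
    ≡⟨ conv-swap (partSeries i) (binomials n) (compositionSeries lam) s ⟩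
  conv (binomials n) (compositionSeries (suc i ∷ lam)) s ∎
  where e = monoOf K lam

-- Signs and sums over compositions

sign : ℕ → ℚ
sign m = ι (sgn m)

sign-suc : ∀ m → sign (suc m) ≡ - sign m
sign-suc m = ι-neg (sgn m)

sign-+ : ∀ m k → sign (m ℕ.+ k) ≡ sign m * sign k
sign-+ zero    k = sym (*-identityˡ (sign k))
sign-+ (suc m) k = begin
  sign (suc (m ℕ.+ k))   ≡⟨ sign-suc (m ℕ.+ k) ⟩
  - sign (m ℕ.+ k)       ≡⟨ cong -_ (sign-+ m k) ⟩
  - (sign m * sign k)    ≡⟨ solve 2 (λ x y → ⊝ (x :* y) := (⊝ x) :* y) refl (sign m) (sign k) ⟩
  - sign m * sign k      ≡⟨ cong (_* sign k) (sign-suc m) ⟨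
  sign (suc m) * sign k  ∎

sign-square : ∀ m → sign m * sign m ≡ 1ℚ
sign-square zero    = refl
sign-square (suc m) = begin
  sign (suc m) * sign (suc m)  ≡⟨ cong₂ _*_ (sign-suc m) (sign-suc m) ⟩
  - sign m * - sign m          ≡⟨ solve 1 (λ x → (⊝ x) :* (⊝ x) := x :* x) refl (sign m) ⟩
  sign m * sign m              ≡⟨ sign-square m ⟩
  1ℚ                           ∎

sign-∸ : ∀ {p s} d → p ≤ s → sign (s ℕ.+ d) * sign p ≡ sign (s ∸ p ℕ.+ d)
sign-∸ {p} {s} d p≤s = begin
  sign (s ℕ.+ d) * sign p
    ≡⟨ cong (λ z → sign (z ℕ.+ d) * sign p) (ℕ.m+[n∸m]≡n p≤s) ⟨
  sign (p ℕ.+ (s ∸ p) ℕ.+ d) * sign p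
    ≡⟨ cong (λ z → sign z * sign p) (ℕ.+-assoc p (s ∸ p) d) ⟩
  sign (p ℕ.+ (s ∸ p ℕ.+ d)) * sign p
    ≡⟨ cong (_* sign p) (sign-+ p (s ∸ p ℕ.+ d)) ⟩
  sign p * sign (s ∸ p ℕ.+ d) * sign p
    ≡⟨ solve 2 (λ x y → x :* y :* x := x :* x :* y) refl (sign p) (sign (s ∸ p ℕ.+ d)) ⟩
  sign p * sign p * sign (s ∸ p ℕ.+ d)
    ≡⟨ cong (_* sign (s ∸ p ℕ.+ d)) (sign-square p) ⟩
  1ℚ * sign (s ∸ p ℕ.+ d)
    ≡⟨ *-identityˡ (sign (s ∸ p ℕ.+ d)) ⟩
  sign (s ∸ p ℕ.+ d) ∎

powQ-^ : ∀ m j → powQ (ιℕ m) j ≡ ιℕ (m ℕ.^ j)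
powQ-^ m zero    = refl
powQ-^ m (suc j) = trans (cong (ιℕ m *_) (powQ-^ m j)) (sym (ιℕ-* m (m ℕ.^ j)))

alternating-sign : ∀ m j i → alternating m j i ≡ sign i * ιℕ ((i ℕ.+ m) ℕ.^ j)
alternating-sign m j zero    = trans (powQ-^ m j) (sym (*-identityˡ (ιℕ (m ℕ.^ j))))
alternating-sign m j (suc i) = begin
  - alternating (suc m) j i
    ≡⟨ cong -_ (alternating-sign (suc m) j i) ⟩
  - (sign i * ιℕ ((i ℕ.+ suc m) ℕ.^ j))
    ≡⟨ cong (λ z → - (sign i * ιℕ (z ℕ.^ j))) (ℕ.+-suc i m) ⟩
  - (sign i * ιℕ ((suc i ℕ.+ m) ℕ.^ j))
    ≡⟨ solve 2 (λ x y → ⊝ (x :* y) := (⊝ x) :* y) refl (sign i) (ιℕ ((suc i ℕ.+ m) ℕ.^ j)) ⟩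
  - sign i * ιℕ ((suc i ℕ.+ m) ℕ.^ j)
    ≡⟨ cong (_* ιℕ ((suc i ℕ.+ m) ℕ.^ j)) (sign-suc i) ⟨
  sign (suc i) * ιℕ ((suc i ℕ.+ m) ℕ.^ j) ∎

Σ<-cong-< : ∀ N {f g} → (∀ i → i < N → f i ≡ g i) → Σ< N f ≡ Σ< N g
Σ<-cong-< zero    p = refl
Σ<-cong-< (suc N) p = cong₂ _+_ (p 0 (s≤s z≤n)) (Σ<-cong-< N (λ i i<N → p (suc i) (s≤s i<N)))

∑-upTo : ∀ N f → ∑ (upTo N) f ≡ Σ< N f
∑-upTo N f = trans (cong sumQ (List.map-upTo f N)) (sumQ-applyUpTo N f)
  where
  sumQ-applyUpTo : ∀ N f → sumQ (applyUpTo f N) ≡ Σ< N f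
  sumQ-applyUpTo zero    f = refl
  sumQ-applyUpTo (suc N) f = cong (f 0 +_) (sumQ-applyUpTo N (f ∘ suc))

∑-concatMap : ∀ {A B : Set} (u : A → List B) xs h → ∑ (concatMap u xs) h ≡ ∑ xs (λ x → ∑ (u x) h)
∑-concatMap u []       h = refl
∑-concatMap u (x ∷ xs) h = trans (∑-++ (u x) (concatMap u xs) h) (cong (∑ (u x) h +_) (∑-concatMap u xs h))

ι-sumℤ : ∀ {A : Set} (h : A → ℤ) xs → ι (sumℤ (map h xs)) ≡ ∑ xs (ι ∘ h)
ι-sumℤ h []       = refl
ι-sumℤ h (x ∷ xs) = trans (ι-+ (h x) (sumℤ (map h xs))) (cong (ι (h x) +_) (ι-sumℤ h xs))

compositionSum : List ℕ → Seq
compositionSum lam t = ∑ (comps (length lam) t) (ιℕ ∘ monoVal lam)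

compositionSum-∷ : ∀ v lam t → compositionSum (v ∷ lam) t ≡
  Σ< t (λ i → ιℕ (suc i ℕ.^ (v ∸ 1)) * compositionSum lam (t ∸ suc i))
compositionSum-∷ v lam t = begin
  ∑ (comps (suc (length lam)) t) (ιℕ ∘ monoVal (v ∷ lam))
    ≡⟨ ∑-concatMap (λ i → map (suc i ∷_) (comps (length lam) (t ∸ suc i))) (upTo t) (ιℕ ∘ monoVal (v ∷ lam)) ⟩
  ∑ (upTo t) (λ i → ∑ (map (suc i ∷_) (comps (length lam) (t ∸ suc i))) (ιℕ ∘ monoVal (v ∷ lam)))
    ≡⟨ ∑-upTo t (λ i → ∑ (map (suc i ∷_) (comps (length lam) (t ∸ suc i))) (ιℕ ∘ monoVal (v ∷ lam))) ⟩
  Σ< t (λ i → ∑ (map (suc i ∷_) (comps (length lam) (t ∸ suc i))) (ιℕ ∘ monoVal (v ∷ lam)))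
    ≡⟨ Σ<-cong t (λ i → trans (∑-map (suc i ∷_) (comps (length lam) (t ∸ suc i)) (ιℕ ∘ monoVal (v ∷ lam)))
         (trans (∑-cong (comps (length lam) (t ∸ suc i)) (λ ms → ιℕ-* (suc i ℕ.^ (v ∸ 1)) (monoVal lam ms)))
                (∑-scale (comps (length lam) (t ∸ suc i)) (ιℕ (suc i ℕ.^ (v ∸ 1))) (ιℕ ∘ monoVal lam)))) ⟩
  Σ< t (λ i → ιℕ (suc i ℕ.^ (v ∸ 1)) * compositionSum lam (t ∸ suc i)) ∎

-- A composition of t into d parts carries the product of the signs (-1)^(m_i - 1), which is
-- (-1)^(t-d) = (-1)^(t+d).
compositionSeries-sum : ∀ lam t → compositionSeries lam t ≡ sign (t ℕ.+ length lam) * compositionSum lam t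
compositionSeries-sum []        zero    = refl
compositionSeries-sum []        (suc t) = sym (*-zeroʳ (sign (suc t ℕ.+ 0)))
compositionSeries-sum (v ∷ lam) zero    = trans (*-zeroˡ (compositionSeries lam 0)) (sym (*-zeroʳ (sign (suc (length lam)))))
compositionSeries-sum (v ∷ lam) (suc t) = begin
  conv (partSeries j) (compositionSeries lam) (suc t)
    ≡⟨ conv-partSeries-suc j (compositionSeries lam) t ⟩
  conv (alternating 1 j) (compositionSeries lam) t
    ≡⟨ conv-as-Σ< (alternating 1 j) (compositionSeries lam) t ⟩
  Σ< (suc t) (λ i → alternating 1 j i * compositionSeries lam (t ∸ i))
    ≡⟨ Σ<-cong-< (suc t) (λ { i (s≤s i≤t) → term i i≤t }) ⟩
  Σ< (suc t) (λ i → sign (suc t ℕ.+ suc d) * (ιℕ (suc i ℕ.^ j) * compositionSum lam (t ∸ i)))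
    ≡⟨ *-Σ< (suc t) (sign (suc t ℕ.+ suc d)) (λ i → ιℕ (suc i ℕ.^ j) * compositionSum lam (t ∸ i)) ⟨
  sign (suc t ℕ.+ suc d) * Σ< (suc t) (λ i → ιℕ (suc i ℕ.^ j) * compositionSum lam (t ∸ i))
    ≡⟨ cong (sign (suc t ℕ.+ suc d) *_) (compositionSum-∷ v lam (suc t)) ⟨
  sign (suc t ℕ.+ suc d) * compositionSum (v ∷ lam) (suc t) ∎
  where
  j = v ∸ 1
  d = length lam
  sign-drop-two : sign (suc t ℕ.+ suc d) ≡ sign (t ℕ.+ d)
  sign-drop-two = begin
    sign (suc t ℕ.+ suc d)    ≡⟨ cong (sign ∘ suc) (ℕ.+-suc t d) ⟩
    sign (suc (suc (t ℕ.+ d))) ≡⟨ cong ι (ℤ.neg-involutive (sgn (t ℕ.+ d))) ⟩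
    sign (t ℕ.+ d)            ∎
  sign-split : ∀ i → i ≤ t → sign i * sign (t ∸ i ℕ.+ d) ≡ sign (suc t ℕ.+ suc d)
  sign-split i i≤t = begin
    sign i * sign (t ∸ i ℕ.+ d)    ≡⟨ sign-+ i (t ∸ i ℕ.+ d) ⟨
    sign (i ℕ.+ (t ∸ i ℕ.+ d))     ≡⟨ cong sign (ℕ.+-assoc i (t ∸ i) d) ⟨
    sign (i ℕ.+ (t ∸ i) ℕ.+ d)     ≡⟨ cong (λ z → sign (z ℕ.+ d)) (ℕ.m+[n∸m]≡n i≤t) ⟩
    sign (t ℕ.+ d)                 ≡⟨ sign-drop-two ⟨
    sign (suc t ℕ.+ suc d)         ∎
  term : ∀ i → i ≤ t → alternating 1 j i * compositionSeries lam (t ∸ i)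
    ≡ sign (suc t ℕ.+ suc d) * (ιℕ (suc i ℕ.^ j) * compositionSum lam (t ∸ i))
  term i i≤t = begin
    alternating 1 j i * compositionSeries lam (t ∸ i)
      ≡⟨ cong₂ _*_ (trans (alternating-sign 1 j i) (cong (λ z → sign i * ιℕ (z ℕ.^ j)) (ℕ.+-comm i 1)))
           (compositionSeries-sum lam (t ∸ i)) ⟩
    sign i * ιℕ (suc i ℕ.^ j) * (sign (t ∸ i ℕ.+ d) * compositionSum lam (t ∸ i))
      ≡⟨ solve 4 (λ x y z w → x :* y :* (z :* w) := x :* z :* (y :* w)) refl
           (sign i) (ιℕ (suc i ℕ.^ j)) (sign (t ∸ i ℕ.+ d)) (compositionSum lam (t ∸ i)) ⟩
    sign i * sign (t ∸ i ℕ.+ d) * (ιℕ (suc i ℕ.^ j) * compositionSum lam (t ∸ i))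
      ≡⟨ cong (_* (ιℕ (suc i ℕ.^ j) * compositionSum lam (t ∸ i))) (sign-split i i≤t) ⟩
    sign (suc t ℕ.+ suc d) * (ιℕ (suc i ℕ.^ j) * compositionSum lam (t ∸ i)) ∎

ι-innerSum : ∀ s n lam → ι (innerSum s n lam) ≡ Σ< (suc s) (λ p → sign p * binomials n p * compositionSum lam (s ∸ p))
ι-innerSum s n lam = begin
  ι (innerSum s n lam)
    ≡⟨ ι-sumℤ inner (upTo (suc s)) ⟩
  ∑ (upTo (suc s)) (ι ∘ inner)
    ≡⟨ ∑-upTo (suc s) (ι ∘ inner) ⟩
  Σ< (suc s) (ι ∘ inner)
    ≡⟨ Σ<-cong (suc s) (λ p → trans (ι-sumℤ (summand p) (compositions p))
         (trans (∑-cong (compositions p) (ι-summand p))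
                (∑-scale (compositions p) (sign p * binomials n p) (ιℕ ∘ monoVal lam)))) ⟩
  Σ< (suc s) (λ p → sign p * binomials n p * compositionSum lam (s ∸ p)) ∎
  where
  compositions : ℕ → List (List ℕ)
  compositions p = comps (length lam) (s ∸ p)
  summand : ℕ → List ℕ → ℤ
  summand p ms = sgn p ℤ.* (ℤ.+ (n C p)) ℤ.* (ℤ.+ monoVal lam ms)
  inner : ℕ → ℤ
  inner p = sumℤ (map (summand p) (compositions p))
  ι-summand : ∀ p ms → ι (summand p ms) ≡ sign p * binomials n p * ιℕ (monoVal lam ms)
  ι-summand p ms = trans (ι-* (sgn p ℤ.* (ℤ.+ (n C p))) (ℤ.+ monoVal lam ms))
    (cong (_* ιℕ (monoVal lam ms)) (ι-* (sgn p) (ℤ.+ (n C p))))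

-- Compositions of s - p have sign (-1)^(s-p+d) = (-1)^(s+d) (-1)^p; the first factor leaves the sum
-- over p, the second stays with the binomial coefficient.
mainFactor-innerSum : ∀ {K} s n lam → Parts K lam →
  mainFactor n (monoOf K lam) s ≡ sign (s ℕ.+ length lam) * ι (innerSum s n lam)
mainFactor-innerSum {K} s n lam ps = begin
  mainFactor n (monoOf K lam) s
    ≡⟨ mainFactor-monoOf n lam ps s ⟩
  conv (binomials n) (compositionSeries lam) s
    ≡⟨ conv-as-Σ< (binomials n) (compositionSeries lam) s ⟩
  Σ< (suc s) (λ p → binomials n p * compositionSeries lam (s ∸ p))
    ≡⟨ Σ<-cong-< (suc s) (λ { p (s≤s p≤s) → term p p≤s }) ⟩
  Σ< (suc s) (λ p → sign (s ℕ.+ d) * (sign p * binomials n p * compositionSum lam (s ∸ p)))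
    ≡⟨ *-Σ< (suc s) (sign (s ℕ.+ d)) (λ p → sign p * binomials n p * compositionSum lam (s ∸ p)) ⟨
  sign (s ℕ.+ d) * Σ< (suc s) (λ p → sign p * binomials n p * compositionSum lam (s ∸ p))
    ≡⟨ cong (sign (s ℕ.+ d) *_) (ι-innerSum s n lam) ⟨
  sign (s ℕ.+ d) * ι (innerSum s n lam) ∎
  where
  d = length lam
  term : ∀ p → p ≤ s → binomials n p * compositionSeries lam (s ∸ p)
    ≡ sign (s ℕ.+ d) * (sign p * binomials n p * compositionSum lam (s ∸ p))
  term p p≤s = begin
    binomials n p * compositionSeries lam (s ∸ p)
      ≡⟨ cong (binomials n p *_) (trans (compositionSeries-sum lam (s ∸ p))
           (cong (_* compositionSum lam (s ∸ p)) (sym (sign-∸ d p≤s)))) ⟩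
    binomials n p * (sign (s ℕ.+ d) * sign p * compositionSum lam (s ∸ p))
      ≡⟨ solve 4 (λ b x y w → b :* (x :* y :* w) := x :* (y :* b :* w)) refl
           (binomials n p) (sign (s ℕ.+ d)) (sign p) (compositionSum lam (s ∸ p)) ⟩
    sign (s ℕ.+ d) * (sign p * binomials n p * compositionSum lam (s ∸ p)) ∎

-- Assembling the coefficient formula

powerSum-sSums : ∀ s k A → powerSum k (sSums s A) ≡ ιℕ (k !) * sumsPow s k A
powerSum-sSums s k A = trans
  (∑-cong (sSums s A) (λ z → sym (trans (cong (ιℕ (k !) *_) (divPow-powQ z k)) (ιℕ-inv-cancel (k !) {{k ℕ.!≢0}} (powQ z k)))))
  (∑-scale (sSums s A) (ιℕ (k !)) (λ z → divPow z k))

fromVec : ∀ {n} (P : List ℚ → Set) → (∀ (A : Vec ℚ n) → P (toList A)) → ∀ A → length A ≡ n → P A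
fromVec P p A refl = subst P (Vec.toList∘fromList A) (p (Vec.fromList A))

-- The factor k! undoes the division by k! in `sumsPow`; multiplying by `den lam` then reduces the
-- claim to equal numerators.
closedCoeff-cFormula : ∀ s k n lam → Parts k lam → ιℕ (k !) * closedCoeff n s (monoOf k lam) ≡ cFormula s k n lam
closedCoeff-cFormula s k n lam ps = ιℕ-cancel (den lam) {{den≢0 lam}} (begin
  ιℕ (k !) * (mainFactor n (monoOf k lam) s * inv (denom (monoOf k lam))) * ιℕ (den lam)
    ≡⟨ cong₂ (λ x d → ιℕ (k !) * (x * inv d) * ιℕ (den lam)) (mainFactor-innerSum s n lam ps) (denom-monoOf lam ps) ⟩
  ιℕ (k !) * (sign (s ℕ.+ length lam) * ι (innerSum s n lam) * inv (den lam)) * ιℕ (den lam)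
    ≡⟨ solve 5 (λ f g i v d → f :* (g :* i :* v) :* d := v :* (d :* (g :* f :* i))) refl
         (ιℕ (k !)) (sign (s ℕ.+ length lam)) (ι (innerSum s n lam)) (inv (den lam)) (ιℕ (den lam)) ⟩
  inv (den lam) * (ιℕ (den lam) * (sign (s ℕ.+ length lam) * ιℕ (k !) * ι (innerSum s n lam)))
    ≡⟨ inv-ιℕ-cancel (den lam) {{den≢0 lam}} _ ⟩
  sign (s ℕ.+ length lam) * ιℕ (k !) * ι (innerSum s n lam)
    ≡⟨ trans (ι-* (sgn (s ℕ.+ length lam) ℤ.* (ℤ.+ (k !))) (innerSum s n lam)) (cong (_* ι (innerSum s n lam)) (ι-* (sgn (s ℕ.+ length lam)) (ℤ.+ (k !)))) ⟨
  ι (sgn (s ℕ.+ length lam) ℤ.* (ℤ.+ (k !)) ℤ.* innerSum s n lam)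
    ≡⟨ ι/-cancel (sgn (s ℕ.+ length lam) ℤ.* (ℤ.+ (k !)) ℤ.* innerSum s n lam) (den lam) {{den≢0 lam}} ⟨
  cFormula s k n lam * ιℕ (den lam) ∎)

theorem2p1 : (s k n : ℕ) → s ≤ n → k ≤ n →
    (Q : Poly k) →
    (∀ (A : Vec ℚ n) →
    powerSum k (sSums s (toList A))
    ≡ evalPoly Q (λ i → powerSum (suc (toℕ i)) (toList A))) →
    (lam : List ℕ) → IsPartition k lam →
    coeff Q (monoOf k lam) ≡ cFormula s k n lam
theorem2p1 s k n s≤n k≤n Q hyp lam part = begin
  coeff Q e
    -- Uniqueness reaches exponent vectors of weight at most n; this one has weight k.
    ≡⟨ coeff-unique n Q (scalePoly (ιℕ (k !)) (poly rep)) same-values e (ℕ.≤-trans (ℕ.≤-reflexive weight≡) k≤n) ⟩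
  coeff (scalePoly (ιℕ (k !)) (poly rep)) e
    ≡⟨ coeff-scale (ιℕ (k !)) (poly rep) e ⟩
  ιℕ (k !) * coeff (poly rep) e
    ≡⟨ cong (ιℕ (k !) *_) (coeffs rep e weight≡) ⟩
  ιℕ (k !) * closedCoeff n s e
    ≡⟨ closedCoeff-cFormula s k n lam ps ⟩
  cFormula s k n lam ∎
  where
  open IsPartition part
  e = monoOf k lam
  ps = parts-bounded lam positive (ℕ.≤-reflexive sums-to)
  weight≡ : weight e ≡ k
  weight≡ = trans (weight-monoOf lam ps) sums-to
  rep = Existence.represented-sumsPow k n k ℕ.≤-refl s
  same-values : ∀ A → length A ≡ n →
    evalPoly Q (powerSums A ∘ toℕ) ≡ evalPoly (scalePoly (ιℕ (k !)) (poly rep)) (powerSums A ∘ toℕ)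
  same-values A l = begin
    evalPoly Q (powerSums A ∘ toℕ)
      ≡⟨ fromVec (λ A → powerSum k (sSums s A) ≡ evalPoly Q (powerSums A ∘ toℕ)) hyp A l ⟨
    powerSum k (sSums s A)
      ≡⟨ powerSum-sSums s k A ⟩
    ιℕ (k !) * sumsPow s k A
      ≡⟨ cong (ιℕ (k !) *_) (values rep A l) ⟨
    ιℕ (k !) * evalPoly (poly rep) (powerSums A ∘ toℕ)
      ≡⟨ evalPoly-scale (ιℕ (k !)) (poly rep) _ ⟨
    evalPoly (scalePoly (ιℕ (k !)) (poly rep)) (powerSums A ∘ toℕ) ∎
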